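{- A digraph $H$ is a hero in oriented chordal graphs if and only if $H$ is a transitive tournament or $H$ is isomorphic to $\vec{C}_3(1,1,k)$ for some integer $k\ge 1$.
   Context: An oriented chordal graph is an orientation (each edge given exactly one direction) of a chordal graph, i.e. of a graph in which every cycle of length at least 4 has a chord. The dichromatic number of a digraph is the least number of parts in a partition of its vertex set into sets inducing acyclic subdigraphs. A digraph $H$ is a hero in a class $\mathcal{C}$ if there is a constant $c$ such that every digraph in $\mathcal{C}$ with no induced subdigraph isomorphic to $H$ has dichromatic number at most $c$. A transitive tournament is an acyclic tournament. For digraphs $D_1,D_2,D_3$, $\vec{C}_3(D_1,D_2,D_3)$ is obtained from their disjoint union by adding all arcs from $D_1$ to $D_2$, from $D_2$ to $D_3$ and from $D_3$ to $D_1$, where an integer $m$ stands for the transitive tournament on $m$ vertices. -}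

module Defs where

open import Data.Nat using (ℕ; zero; suc; _+_; _≤_; _<ᵇ_)
open import Data.Fin using (Fin; toℕ; splitAt)
import Data.Fin as F
open import Data.Bool using (Bool; true; false)
open import Data.Sum using (_⊎_; inj₁; inj₂; map₂)
open import Data.Product using (Σ; _×_; ∃; ∃-syntax)
open import Data.Empty using (⊥)
open import Relation.Nullary using (¬_)
open import Relation.Binary.PropositionalEquality using (_≡_; _≢_)
open import Function.Bundles using (_↔_; Inverse)
open import Function.Definitions using (Injective)

-- A finite digraph on vertex set Fin size, arcs given by a Boolean matrix
-- (so there are no parallel arcs; digons and loops are representable).
record Digraph : Set where
  constructor digraph
  field
    size : ℕ
    arc  : Fin size → Fin size → Bool
open Digraph public

Arc : (D : Digraph) → Fin (size D) → Fin (size D) → Set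
Arc D i j = arc D i j ≡ true

Adj : (D : Digraph) → Fin (size D) → Fin (size D) → Set
Adj D i j = Arc D i j ⊎ Arc D j i

Loopless : Digraph → Set
Loopless D = ∀ i → arc D i i ≡ false

Consec : (k : ℕ) → Fin k → Fin k → Set
Consec k i j = (toℕ j ≡ suc (toℕ i)) ⊎ ((suc (toℕ i) ≡ k) × (toℕ j ≡ 0))

Oriented : Digraph → Set
Oriented D = Loopless D × (∀ i j → Arc D i j → ¬ Arc D j i)

Chordal : Digraph → Set
Chordal D =
  ∀ (k : ℕ) → 4 ≤ k → (c : Fin k → Fin (size D)) → Injective _≡_ _≡_ c →
  (∀ i j → Consec k i j → Adj D (c i) (c j)) →
  ∃[ i ] ∃[ j ] (i ≢ j × ¬ Consec k i j × ¬ Consec k j i × Adj D (c i) (c j))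

OrientedChordal : Digraph → Set
OrientedChordal D = Oriented D × Chordal D

DirCycle : (D : Digraph) (k : ℕ) → (Fin (suc k) → Fin (size D)) → Set
DirCycle D k cyc = Injective _≡_ _≡_ cyc × (∀ i j → Consec (suc k) i j → Arc D (cyc i) (cyc j))

Acyclic : Digraph → Set
Acyclic D = ∀ k cyc → ¬ DirCycle D k cyc

AcyclicColouring : (D : Digraph) (c : ℕ) → (Fin (size D) → Fin c) → Set
AcyclicColouring D c col =
  ∀ k cyc → DirCycle D k cyc → ¬ (∀ i → col (cyc i) ≡ col (cyc F.zero))

DichromaticAtMost : Digraph → ℕ → Set
DichromaticAtMost D c = Σ (Fin (size D) → Fin c) (AcyclicColouring D c)

InducedIn : Digraph → Digraph → Set
InducedIn H D = Σ (Fin (size H) → Fin (size D)) λ f →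
  Injective _≡_ _≡_ f × (∀ i j → arc D (f i) (f j) ≡ arc H i j)

Isomorphic : Digraph → Digraph → Set
Isomorphic H D = Σ (Fin (size H) ↔ Fin (size D)) λ f →
  ∀ i j → arc D (Inverse.to f i) (Inverse.to f j) ≡ arc H i j

Hero : (Digraph → Set) → Digraph → Set
Hero 𝒞 H = ∃[ c ] (∀ D → 𝒞 D → ¬ InducedIn H D → DichromaticAtMost D c)

Tournament : Digraph → Set
Tournament D = Loopless D ×
  (∀ i j → i ≢ j → (Arc D i j × ¬ Arc D j i) ⊎ (Arc D j i × ¬ Arc D i j))

TransitiveTournament : Digraph → Set
TransitiveTournament D = Tournament D × Acyclic D

TT : ℕ → Digraph
TT m = digraph m (λ i j → toℕ i <ᵇ toℕ j)

private
  c3arc : (D₁ D₂ D₃ : Digraph) →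
    Fin (size D₁) ⊎ (Fin (size D₂) ⊎ Fin (size D₃)) →
    Fin (size D₁) ⊎ (Fin (size D₂) ⊎ Fin (size D₃)) → Bool
  c3arc D₁ D₂ D₃ (inj₁ x) (inj₁ y) = arc D₁ x y
  c3arc D₁ D₂ D₃ (inj₂ (inj₁ x)) (inj₂ (inj₁ y)) = arc D₂ x y
  c3arc D₁ D₂ D₃ (inj₂ (inj₂ x)) (inj₂ (inj₂ y)) = arc D₃ x y
  c3arc D₁ D₂ D₃ (inj₁ _) (inj₂ (inj₁ _)) = true
  c3arc D₁ D₂ D₃ (inj₂ (inj₁ _)) (inj₂ (inj₂ _)) = true
  c3arc D₁ D₂ D₃ (inj₂ (inj₂ _)) (inj₁ _) = true
  c3arc D₁ D₂ D₃ _ _ = false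

C3 : Digraph → Digraph → Digraph → Digraph
C3 D₁ D₂ D₃ = digraph (size D₁ + (size D₂ + size D₃))
  (λ x y → c3arc D₁ D₂ D₃ (part x) (part y))
  where
  part : Fin (size D₁ + (size D₂ + size D₃)) → Fin (size D₁) ⊎ (Fin (size D₂) ⊎ Fin (size D₃))
  part x = map₂ (splitAt (size D₂)) (splitAt (size D₁) x)

module Submission where

-- An oriented chordal graph has a simplicial elimination order, and a directed cycle in it
-- contains a directed triangle.  Colour greedily along the order: only the in-neighbours of the
-- new vertex u that lie on a directed triangle with u have to be avoided.  If they showed
-- 2 ^ (2k + 1) colours, they would contain a transitive tournament on 2k + 1 vertices with first
-- vertex b; taking u → a → b, k of the others are all dominated by a or all dominate a, and
-- these complete u → a or a → b to C3(1,1,k).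
--
-- Conversely, two families of oriented chordal graphs have unbounded dichromatic number.  In the
-- first, every arc of a transitive tournament on n + 1 vertices is closed by a copy of the
-- previous graph; so a tournament H inside it that has a directed triangle has an arc a → b with
-- b ⇒ H ∖ {a, b} ⇒ a, or a directed triangle that dominates or is dominated by a vertex.  In the
-- second, and in its reverse for the dual pattern, no vertex dominates a directed triangle:
-- blocks of distinctly coloured vertices are stacked, each in front of the earlier ones, until two
-- blocks U ⇒ W have the same colours, and then a new vertex y with y ⇒ U and W ⇒ y has a new
-- colour and can be added to W.  A hero therefore is a tournament with no directed triangle, or
-- it has such an arc a → b and H ∖ {a, b} is transitive.

open import Defs
open import Data.Bool using (Bool; true; false; not; _∨_; _∧_)
import Data.Bool.Properties as Bool
open import Data.Empty using (⊥; ⊥-elim)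
open import Data.Fin using (Fin; zero; suc; toℕ; fromℕ; fromℕ<; inject₁; inject≤; punchOut; finToFun; funToFin)
import Data.Fin as F
open import Data.Fin.Properties using (toℕ-fromℕ; toℕ-inject₁; toℕ-inject≤; toℕ-fromℕ<; toℕ<n; toℕ-injective; any?; all?; pigeonhole; punchOut-injective; finToFun-funToFin; ∀-cons; +↔⊎; *↔×)
import Data.Fin.Properties as F
open import Data.List using (List; []; _∷_; _++_; length; lookup; tabulate; filter; allFin)
open import Data.List.Membership.Propositional using (_∈_; lose)
open import Data.List.Membership.Propositional.Properties using (∈-filter⁺; ∈-filter⁻; ∈-allFin; ∈-lookup)
open import Data.List.Properties using (filter-notAll; length-tabulate; length-++)
open import Data.List.Relation.Binary.Sublist.Propositional using (_⊆_; []; _∷_; _∷ʳ_)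
open import Data.List.Relation.Binary.Sublist.Propositional.Properties using (All-resp-⊆)
open import Data.List.Relation.Binary.Subset.Propositional.Properties using (∷⁺ʳ)
open import Data.List.Relation.Unary.All as All using (All; []; _∷_)
import Data.List.Relation.Unary.All.Properties as All
open import Data.List.Relation.Unary.AllPairs as AllPairs using (AllPairs; []; _∷_)
import Data.List.Relation.Unary.AllPairs.Properties as AllPairs
open import Data.List.Relation.Unary.Any using (here; there)
import Data.List.Relation.Unary.Any as Any
open import Data.List.Relation.Unary.Any.Properties using (lookup-index)
import Data.List.Relation.Unary.Unique.Propositional.Properties as Unique
open import Data.Nat using (ℕ; zero; suc; _+_; _*_; _^_; _≤_; _<_; z≤n; s≤s; z<s; s<s; _≤?_; _<?_; _<ᵇ_; nonZero)
open import Data.Nat.Induction using (Acc; acc; <-wellFounded)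
open import Data.Nat.Properties using (≤-refl; ≤-reflexive; ≤-trans; ≤-antisym; ≤-total; <-irrefl; <-asym; <-trans; <-cmp; <⇒≤; <⇒≢; ≤-<-trans; <-≤-trans; ≮⇒≥; ≰⇒>; ≤∧≢⇒<; n<1+n; m≤m+n; m≤n+m; m<m+n; +-comm; +-assoc; +-suc; +-identityʳ; +-monoˡ-<; +-monoʳ-<; +-monoʳ-≤; +-mono-≤; +-cancelˡ-≡; m≤n⇒∃[o]m+o≡n; ≤-pred; suc-injective; <⇒<ᵇ; <ᵇ⇒<; m^n>0)
import Data.Nat.Properties as ℕ
open import Data.Product using (Σ; _×_; ∃; ∃₂; ∃-syntax; _,_; proj₁; proj₂)
open import Data.Product.Function.NonDependent.Propositional using (_×-↔_)
open import Data.Sum using (_⊎_; inj₁; inj₂; swap; [_,_]′)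
open import Data.Sum.Function.Propositional using (_⊎-↔_)
open import Data.Sum.Properties using (inj₁-injective)
open import Data.Unit using (⊤)
open import Function using (_∘_; id; case_of_; _⇔_; mk⇔; Equivalence)
open import Function.Bundles using (_↔_; Inverse; mk↔ₛ′)
open import Function.Construct.Composition using (_↔-∘_)
open import Function.Construct.Identity using (↔-id)
open import Function.Definitions using (Injective)
open import Relation.Binary using (tri<; tri≈; tri>)
open import Relation.Binary.Construct.Closure.ReflexiveTransitive as Star using (Star; ε; _◅_; _◅◅_)
open import Relation.Binary.PropositionalEquality using (_≡_; _≢_; refl; sym; trans; cong; cong₂; subst; subst₂)
open import Relation.Nullary using (¬_; Dec; yes; no)
open import Relation.Nullary.Decidable using (_×-dec_; _⊎-dec_; _→-dec_; ¬?; ¬¬-excluded-middle; decidable-stable; map′; does; dec-true)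

-- Adjacency in digraphs

V : Digraph → Set
V D = Fin (size D)

arc? : ∀ D x y → Dec (Arc D x y)
arc? D x y = arc D x y Bool.≟ true

adj? : ∀ D x y → Dec (Adj D x y)
adj? D x y = arc? D x y ⊎-dec arc? D y x

adj-irrefl : ∀ D → Loopless D → ∀ {x} → ¬ Adj D x x
adj-irrefl D ll {x} (inj₁ a) = case trans (sym (ll x)) a of λ ()
adj-irrefl D ll {x} (inj₂ a) = case trans (sym (ll x)) a of λ ()

-- Cycles and chords

cyclic-pred : ∀ {k} (i : Fin k) → ∃ λ p → Consec k p i
cyclic-pred {suc k} zero    = fromℕ k , inj₂ (cong suc (toℕ-fromℕ k) , refl)
cyclic-pred {suc k} (suc i) = inject₁ i , inj₁ (cong suc (sym (toℕ-inject₁ i)))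

cyclic-succ : ∀ {k} (i : Fin k) → ∃ λ s → Consec k i s
cyclic-succ {suc k} i with suc (toℕ i) <? suc k
... | yes lt = fromℕ< lt , inj₁ (toℕ-fromℕ< lt)
... | no ≮   = zero , inj₂ (≤-antisym (toℕ<n i) (≮⇒≥ ≮) , refl)

-- On a triangle `p` and `s` would be consecutive, and on a digon equal; these short cycles are what
-- 4 ≤ k excludes. The relation `Next` is `Consec` on plain numbers, where each step either adds one
-- or wraps to 0.
neighbours-nonconsecutive : ∀ {k} → 4 ≤ k → (p i s : Fin k) → Consec k p i → Consec k i s →
  p ≢ s × ¬ Consec k p s × ¬ Consec k s p
neighbours-nonconsecutive 4≤k p i s c c′ =
  let a , b , b′ = lemma 4≤k c c′ in (a ∘ cong toℕ) , b , b′
  where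
  Next : ℕ → ℕ → ℕ → Set
  Next k a b = (b ≡ suc a) ⊎ ((suc a ≡ k) × (b ≡ 0))
  lemma : ∀ {k a b c} → 4 ≤ k → Next k a b → Next k b c → a ≢ c × ¬ Next k a c × ¬ Next k c a
  lemma 4≤k (inj₁ refl) (inj₁ refl) =
    (λ ()) , (λ { (inj₁ ()) ; (inj₂ (_ , ())) }) ,
    (λ { (inj₁ ()) ; (inj₂ (refl , refl)) → case 4≤k of λ { (s≤s (s≤s (s≤s ()))) } })
  lemma 4≤k (inj₁ refl) (inj₂ (refl , refl)) =
    (λ { refl → case 4≤k of λ { (s≤s (s≤s ())) } }) ,
    (λ { (inj₁ ()) ; (inj₂ (() , _)) }) ,
    (λ { (inj₁ refl) → case 4≤k of λ { (s≤s (s≤s (s≤s ()))) } ; (inj₂ (() , _)) })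
  lemma 4≤k (inj₂ (refl , refl)) (inj₁ refl) =
    (λ { refl → case 4≤k of λ { (s≤s (s≤s ())) } }) ,
    (λ { (inj₁ refl) → case 4≤k of λ { (s≤s ()) } ; (inj₂ (_ , ())) }) ,
    (λ { (inj₁ refl) → case 4≤k of λ { (s≤s (s≤s (s≤s ()))) }
       ; (inj₂ (refl , _)) → case 4≤k of λ { (s≤s (s≤s ())) } })
  lemma 4≤k (inj₂ (refl , refl)) (inj₂ (refl , _)) = case 4≤k of λ { (s≤s ()) }

argmax : ∀ {k} (f : Fin (suc k) → ℕ) → ∃ λ i → ∀ j → f j ≤ f i
argmax {zero}  f = zero , λ { zero → ≤-refl }
argmax {suc k} f with argmax (f ∘ suc)
... | i , max with ≤-total (f zero) (f (suc i))
...   | inj₁ le = suc i , λ { zero → le ; (suc j) → max j }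
...   | inj₂ ge = zero , λ { zero → ≤-refl ; (suc j) → ≤-trans (max j) ge }

-- The two cycle-neighbours of a vertex of maximal rank on the cycle are joined by a chord.
chordal-by-rank : ∀ D (rank : V D → ℕ) →
  (∀ x y → Adj D x y → rank x ≢ rank y) →
  (∀ x y z → Adj D x y → Adj D x z → rank y < rank x → rank z < rank x → y ≢ z → Adj D y z) →
  Chordal D
chordal-by-rank D rank distinct simplicial (suc k) 4≤k c inj cyc
  with i , max ← argmax (rank ∘ c)
  with p , ci ← cyclic-pred i | s , cs ← cyclic-succ i
  with p≢s , a , b ← neighbours-nonconsecutive 4≤k p i s ci cs
  = p , s , p≢s , a , b ,
    simplicial (c i) (c p) (c s) ip is
      (≤∧≢⇒< (max p) (distinct _ _ ip ∘ sym)) (≤∧≢⇒< (max s) (distinct _ _ is ∘ sym)) (p≢s ∘ inj)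
  where
  ip = swap (cyc p i ci)
  is = cyc i s cs

repeated? : ∀ {k n} (c : Fin k → Fin n) → Injective _≡_ _≡_ c ⊎ ∃₂ λ i j → i F.< j × c i ≡ c j
repeated? c with any? (λ i → any? (λ j → (i F.<? j) ×-dec (c i F.≟ c j)))
... | yes (i , j , r) = inj₂ (i , j , r)
... | no none = inj₁ λ {x} {y} e → case <-cmp (toℕ x) (toℕ y) of λ where
  (tri< l _ _) → ⊥-elim (none (x , y , l , e))
  (tri≈ _ l _) → toℕ-injective l
  (tri> _ _ l) → ⊥-elim (none (y , x , l , sym e))

-- With repetition as a second outcome, chordality applies to every closed walk, and no cycle has to
-- be extracted first.
repetition-or-chord : ∀ D → Chordal D → ∀ {k} → 4 ≤ k → (c : Fin k → V D) →
  (∀ i j → Consec k i j → Adj D (c i) (c j)) →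
  ∃₂ λ i j → i F.< j × (c i ≡ c j ⊎ (¬ Consec k i j × ¬ Consec k j i × Adj D (c i) (c j)))
repetition-or-chord D ch 4≤k c cyc with repeated? c
... | inj₂ (i , j , l , e) = i , j , l , inj₁ e
... | inj₁ inj with ch _ 4≤k c inj cyc
...   | i , j , i≢j , a , b , adj = case <-cmp (toℕ i) (toℕ j) of λ where
  (tri< l _ _) → i , j , l , inj₂ (a , b , adj)
  (tri≈ _ l _) → ⊥-elim (i≢j (toℕ-injective l))
  (tri> _ _ l) → j , i , l , inj₂ (b , a , swap adj)

-- Walks

Walk : ∀ {A : Set} → (A → A → Set) → ℕ → (ℕ → A) → Set
Walk R m g = ∀ t → t < m → R (g t) (g (suc t))

-- The index map of a shortcut that jumps from i to suc i + d.
skip : ℕ → ℕ → ℕ → ℕ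
skip i d t with t ≤? i
... | yes _ = t
... | no _  = t + d

skip-≤ : ∀ {i d t} → t ≤ i → skip i d t ≡ t
skip-≤ {i} {d} {t} le with t ≤? i
... | yes _ = refl
... | no ¬p = ⊥-elim (¬p le)

skip-> : ∀ {i d t} → i < t → skip i d t ≡ t + d
skip-> {i} {d} {t} lt with t ≤? i
... | yes p = ⊥-elim (<-irrefl refl (<-≤-trans lt p))
... | no _  = refl

skip-mono-< : ∀ {i d t u} → t < u → skip i d t < skip i d u
skip-mono-< {i} {d} {t} {u} lt with t ≤? i | u ≤? i
... | yes _ | yes _ = lt
... | yes _ | no _  = <-≤-trans lt (m≤m+n u d)
... | no a  | yes b = ⊥-elim (a (≤-trans (<⇒≤ lt) b))
... | no _  | no _  = +-monoˡ-< d lt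

skip-mono-≤ : ∀ {i d t u} → t ≤ u → skip i d t ≤ skip i d u
skip-mono-≤ {t = t} {u} le with t ℕ.≟ u
... | yes refl = ≤-refl
... | no ne    = <⇒≤ (skip-mono-< (≤∧≢⇒< le ne))

skip-end : ∀ i d e → skip i d (suc i + e) ≡ suc i + d + e
skip-end i d e = trans (skip-> (s≤s (m≤m+n i e)))
  (trans (+-assoc (suc i) e d) (trans (cong (suc i +_) (+-comm e d)) (sym (+-assoc (suc i) d e))))

-- Here `d` counts the vertices bypassed and `e` the steps that remain after the jump. The given
-- relation supplies the step at `i`; every other step is an old one, shifted by `d` beyond the
-- jump.
shortcut : ∀ {A : Set} (R : A → A → Set) g i d e → Walk R (suc i + d + e) g →
  R (g i) (g (suc i + d)) → Walk R (suc i + e) (g ∘ skip i d)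
shortcut R g i d e w r t t< with <-cmp t i
... | tri< lt _ _ = subst₂ (λ x y → R (g x) (g y)) (sym (skip-≤ {d = d} (<⇒≤ lt))) (sym (skip-≤ {d = d} lt))
                      (w t (≤-trans lt (≤-trans (ℕ.n≤1+n i) (≤-trans (m≤m+n (suc i) d) (m≤m+n _ e)))))
... | tri≈ _ refl _ = subst₂ (λ x y → R (g x) (g y)) (sym (skip-≤ {d = d} ≤-refl)) (sym (skip-> {d = d} (n<1+n i))) r
... | tri> _ _ gt = subst₂ (λ x y → R (g x) (g y)) (sym (skip-> {d = d} gt)) (sym (skip-> {d = d} (<-trans gt (n<1+n t))))
                      (w (t + d) (subst (t + d <_) eq (+-monoˡ-< d t<)))
  where
  eq : suc i + e + d ≡ suc i + d + e
  eq = trans (+-assoc (suc i) e d) (trans (cong (suc i +_) (+-comm e d)) (sym (+-assoc (suc i) d e)))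

shortcut-length : ∀ i d e → 0 < d → suc i + e < suc i + d + e
shortcut-length i d e 0<d = +-monoˡ-< e (m<m+n (suc i) 0<d)

skipped>0 : ∀ {i d} → suc i + d ≢ suc i → 0 < d
skipped>0 {i} {zero}  ne = ⊥-elim (ne (+-identityʳ (suc i)))
skipped>0 {i} {suc d} ne = z<s

-- Directed triangles inside closed walks

DirTriangle : (D : Digraph) → V D → V D → V D → Set
DirTriangle D x y z = Arc D x y × Arc D y z × Arc D z x

module _ (D : Digraph) (oc : OrientedChordal D) (P : V D → Set) where
  private
    ll   = proj₁ (proj₁ oc)
    asym = proj₂ (proj₁ oc)
    ch   = proj₂ oc

  private
    Triangle : Set
    Triangle = ∃ λ x → ∃₂ λ y z → DirTriangle D x y z × P x × P y × P z

    -- The walk has m + 1 vertices, the closing arc being separate. Carrying `P` along keeps the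
    -- final triangle inside a prescribed class.
    ClosedWalk : ℕ → (ℕ → V D) → Set
    ClosedWalk m g = Walk (Arc D) m g × Arc D (g m) (g 0) × (∀ t → t ≤ m → P (g t))

    ShorterHaveTriangle : ℕ → Set
    ShorterHaveTriangle m = ∀ {m′} → m′ < m → (g : ℕ → V D) → ClosedWalk m′ g → Triangle

    -- The segment from `i` to the vertex before `j` closes up, because the next vertex is `g i`
    -- again.
    cut-repetition : ∀ {m} → ShorterHaveTriangle m → ∀ {g} → ClosedWalk m g →
      ∀ i j → i < j → j ≤ m → g i ≡ g j → Triangle
    cut-repetition ih {g} (w , _ , pg) i j i<j j≤m e with d , refl ← m≤n⇒∃[o]m+o≡n i<j =
      ih (≤-<-trans (m≤n+m d i) j≤m) (λ t → g (i + t))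
        ((λ t t<d → subst (λ x → Arc D (g (i + t)) (g x)) (sym (+-suc i t)) (w (i + t) (<-trans (+-monoʳ-< i t<d) j≤m)))
        , subst (Arc D (g (i + d))) (trans (sym e) (cong g (sym (+-identityʳ i)))) (w (i + d) j≤m)
        , (λ t t≤d → pg (i + t) (≤-trans (+-monoʳ-≤ i t≤d) (<⇒≤ j≤m))))

    -- A forward arc bypasses the vertices strictly between; a backward arc closes the segment from
    -- `i` to `j`. The two inequalities exclude the arcs of the closed walk itself, so either result
    -- is strictly shorter.
    cut-chord : ∀ {m} → ShorterHaveTriangle m → ∀ {g} → ClosedWalk m g →
      ∀ i j → i < j → j ≤ m → j ≢ suc i → (i ≡ 0 → j ≢ m) → Adj D (g i) (g j) → Triangle
    cut-chord ih {g} (w , close , pg) i j i<j j≤m ne _ (inj₁ a)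
      with d , refl ← m≤n⇒∃[o]m+o≡n i<j | e , refl ← m≤n⇒∃[o]m+o≡n j≤m =
      ih (shortcut-length i d e (skipped>0 ne)) (g ∘ skip i d)
        (shortcut (Arc D) g i d e w a
        , subst₂ (λ x y → Arc D (g x) (g y)) (sym (skip-end i d e)) (sym (skip-≤ {i} {d} z≤n)) close
        , (λ t t≤ → pg _ (subst (skip i d t ≤_) (skip-end i d e) (skip-mono-≤ {i} {d} t≤))))
    cut-chord {m} ih {g} (w , close , pg) i j i<j j≤m _ ne (inj₂ a) with d , refl ← m≤n⇒∃[o]m+o≡n i<j =
      ih (smaller i ne j≤m) (λ t → g (i + t))
        ((λ t t<d → subst (λ x → Arc D (g (i + t)) (g x)) (sym (+-suc i t))
             (w (i + t) (<-≤-trans (subst (i + t <_) (+-suc i d) (+-monoʳ-< i t<d)) j≤m)))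
        , subst₂ (λ x y → Arc D (g x) (g y)) (sym (+-suc i d)) (sym (+-identityʳ i)) a
        , (λ t t≤d → pg (i + t) (≤-trans (subst (i + t ≤_) (+-suc i d) (+-monoʳ-≤ i t≤d)) j≤m)))
      where
      smaller : ∀ i → (i ≡ 0 → suc i + d ≢ m) → suc i + d ≤ m → suc d < m
      smaller zero    ne le = ≤∧≢⇒< le (ne refl)
      smaller (suc i) ne le = <-≤-trans (s≤s (s≤s (m≤n+m d i))) le

  -- Strong induction on the length: four or more vertices force a repetition or a chord, and both
  -- lead to a shorter closed walk. Loops and digons do not occur, so the descent ends at a
  -- triangle.
  closed-walk⇒triangle : ∀ m → Acc _<_ m → (g : ℕ → V D) → ClosedWalk m g → Triangle
  closed-walk⇒triangle 0 _ g (_ , close , _) = ⊥-elim (adj-irrefl D ll (inj₁ close))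
  closed-walk⇒triangle 1 _ g (w , close , _) = ⊥-elim (asym _ _ close (w 0 z<s))
  closed-walk⇒triangle 2 _ g (w , close , pg) =
    g 0 , g 1 , g 2 , (w 0 z<s , w 1 (s<s z<s) , close) , pg 0 z≤n , pg 1 (s≤s z≤n) , pg 2 ≤-refl
  closed-walk⇒triangle m@(suc (suc (suc _))) (acc rs) g cw@(w , close , pg) =
    case repetition-or-chord D ch {suc m} (s≤s (s≤s (s≤s (s≤s z≤n)))) (g ∘ toℕ) consec of λ where
      (i , j , i<j , inj₁ e) → cut-repetition ih cw (toℕ i) (toℕ j) i<j (≤-pred (toℕ<n j)) e
      (i , j , i<j , inj₂ (¬ij , ¬ji , adj)) → cut-chord ih cw (toℕ i) (toℕ j) i<j (≤-pred (toℕ<n j))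
        (λ e → ¬ij (inj₁ e)) (λ e e′ → ¬ji (inj₂ (cong suc e′ , e))) adj
    where
    ih : ShorterHaveTriangle m
    ih lt g′ = closed-walk⇒triangle _ (rs lt) g′
    consec : ∀ i j → Consec (suc m) i j → Adj D (g (toℕ i)) (g (toℕ j))
    consec i j (inj₁ e) = inj₁ (subst (λ x → Arc D (g (toℕ i)) (g x)) (sym e)
      (w (toℕ i) (≤-pred (subst (_< suc m) e (toℕ<n j)))))
    consec i j (inj₂ (e , e′)) =
      inj₁ (subst₂ (λ x y → Arc D (g x) (g y)) (sym (suc-injective e)) (sym e′) close)

  -- With `P` a colour class, this reduces acyclic colourings to colourings without monochromatic
  -- directed triangles.
  cycle⇒triangle : ∀ k cyc → DirCycle D k cyc → (∀ i → P (cyc i)) →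
    ∃ λ x → ∃₂ λ y z → DirTriangle D x y z × P x × P y × P z
  cycle⇒triangle k cyc (_ , arcs) pc =
    closed-walk⇒triangle k (<-wellFounded k) g
      (walk , arcs _ _ (inj₂ (cong suc (toℕ-at ≤-refl) , refl)) , (λ t _ → pc (at t)))
    where
    at : ℕ → Fin (suc k)
    at t with t <? suc k
    ... | yes lt = fromℕ< lt
    ... | no _   = zero
    toℕ-at : ∀ {t} → t ≤ k → toℕ (at t) ≡ t
    toℕ-at {t} le with t <? suc k
    ... | yes lt = toℕ-fromℕ< lt
    ... | no ≮   = ⊥-elim (≮ (s≤s le))
    g = cyc ∘ at
    walk : Walk (Arc D) k g
    walk t t<k = arcs _ _ (inj₁ (trans (toℕ-at t<k) (cong suc (sym (toℕ-at (<⇒≤ t<k))))))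

-- Simplicial vertices

Away : (D : Digraph) → V D → V D → Set
Away D v x = v ≢ x × ¬ Adj D v x

away-sym : ∀ D {x y} → Away D x y → Away D y x
away-sym D (ne , na) = (ne ∘ sym) , (na ∘ swap)

Simplicial : (D : Digraph) → (V D → Set) → V D → Set
Simplicial D W u = W u × (∀ x y → W x → W y → Adj D u x → Adj D u y → x ≢ y → Adj D x y)

Covers : ∀ {A : Set} → List A → (A → Set) → Set
Covers l W = ∀ x → W x → x ∈ l

prepend : ∀ {A : Set} → A → (ℕ → A) → ℕ → A
prepend x g zero    = x
prepend x g (suc t) = g t

walk-of : ∀ {A : Set} {R : A → A → Set} {x y} → Star R x y →
  ∃₂ λ m g → Walk R m g × g 0 ≡ x × g m ≡ y
walk-of {x = x} ε = 0 , (λ _ → x) , (λ _ ()) , refl , refl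
walk-of {R = R} {x = x} (r ◅ rs) with m , g , w , refl , e ← walk-of rs =
  suc m , prepend x g , (λ { zero _ → r ; (suc t) (s<s t<) → w t t< }) , refl , e

module _ (D : Digraph) (oc : OrientedChordal D) where
  private
    ll   = proj₁ (proj₁ oc)
    asym = proj₂ (proj₁ oc)
    ch   = proj₂ oc

  -- Together with v, a shortest such walk from s to t would be a chordless cycle.
  common-neighbours-adjacent : ∀ {v s t} → Adj D v s → Adj D v t → s ≢ t → ¬ Adj D s t →
    ∀ m → Acc _<_ m → (g : ℕ → V D) → Walk (Adj D) m g → g 0 ≡ s → g m ≡ t →
    (∀ u → 0 < u → u < m → Away D v (g u)) → ⊥
  common-neighbours-adjacent vs vt s≢t ¬st 0 _ g w e e′ away = s≢t (trans (sym e) e′)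
  common-neighbours-adjacent vs vt s≢t ¬st 1 _ g w e e′ away = ¬st (subst₂ (Adj D) e e′ (w 0 z<s))
  common-neighbours-adjacent {v} {s} {t} vs vt s≢t ¬st m@(suc (suc _)) (acc rs) g w e e′ away =
    case repetition-or-chord D ch {suc (suc m)} (s≤s (s≤s (s≤s (s≤s z≤n)))) cyc consec of λ where
      (zero , suc j , _ , inj₁ r) → at-v (toℕ j) (≤-pred (toℕ<n j)) r
      (zero , suc j , _ , inj₂ (¬ij , ¬ji , a)) → on-v (toℕ j) (≤-pred (toℕ<n j))
        (λ z → ¬ij (inj₁ (cong suc z))) (λ z → ¬ji (inj₂ (cong (λ n → suc (suc n)) z , refl))) a
      (suc i , suc j , s<s i<j , inj₁ r) → repetition (toℕ i) (toℕ j) i<j (≤-pred (toℕ<n j)) r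
      (suc i , suc j , s<s i<j , inj₂ (¬ij , _ , a)) →
        chord (toℕ i) (toℕ j) i<j (≤-pred (toℕ<n j)) (λ z → ¬ij (inj₁ (cong suc z))) a
    where
    -- The candidate cycle is `v` followed by `g 0` to `g m`: m + 2 vertices, where m is at least 2.
    cyc : Fin (suc (suc m)) → V D
    cyc zero    = v
    cyc (suc i) = g (toℕ i)
    consec : ∀ i j → Consec (suc (suc m)) i j → Adj D (cyc i) (cyc j)
    consec zero (suc j) (inj₁ z) = subst (Adj D v) (trans (sym e) (cong g (sym (suc-injective z)))) vs
    consec (suc i) (suc j) (inj₁ z) =
      subst (λ x → Adj D (g (toℕ i)) (g x)) (sym (suc-injective z))
        (w (toℕ i) (≤-pred (subst (_< suc m) (suc-injective z) (toℕ<n j))))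
    consec (suc i) zero (inj₂ (z , _)) =
      swap (subst (Adj D v) (trans (sym e′) (cong g (sym (suc-injective (suc-injective z))))) vt)
    consec zero zero (inj₂ (() , _))
    on-v : ∀ j → j ≤ m → j ≢ 0 → j ≢ m → Adj D v (g j) → ⊥
    on-v zero    j≤m ne ne′ a = ne refl
    on-v (suc j) j≤m ne ne′ a = proj₂ (away (suc j) z<s (≤∧≢⇒< j≤m ne′)) a
    at-v : ∀ j → j ≤ m → v ≢ g j
    at-v zero    j≤m r = adj-irrefl D ll (subst (Adj D v) (trans (sym e) (sym r)) vs)
    at-v (suc j) j≤m r with suc j ℕ.≟ m
    ... | yes z = adj-irrefl D ll (subst (Adj D v) (trans (sym e′) (trans (cong g (sym z)) (sym r))) vt)
    ... | no ne = proj₁ (away (suc j) z<s (≤∧≢⇒< j≤m ne)) r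
    chord : ∀ i j → i < j → j ≤ m → j ≢ suc i → Adj D (g i) (g j) → ⊥
    chord i j i<j j≤m ne a = shorter m≡ w e′ away
      where
      d = proj₁ (m≤n⇒∃[o]m+o≡n i<j)
      d≡ = proj₂ (m≤n⇒∃[o]m+o≡n i<j)
      o = proj₁ (m≤n⇒∃[o]m+o≡n j≤m)
      m≡ : suc i + d + o ≡ m
      m≡ = trans (cong (_+ o) d≡) (proj₂ (m≤n⇒∃[o]m+o≡n j≤m))
      shorter : ∀ {m′} → suc i + d + o ≡ m′ → Walk (Adj D) m′ g → g m′ ≡ t →
        (∀ u → 0 < u → u < m′ → Away D v (g u)) → ⊥
      shorter refl w e′ away = common-neighbours-adjacent vs vt s≢t ¬st (suc i + o)
        (rs (subst (suc i + o <_) m≡ (shortcut-length i d o (skipped>0 (ne ∘ trans (sym d≡))))))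
        (g ∘ skip i d)
        (shortcut (Adj D) g i d o w (subst (λ x → Adj D (g i) (g x)) (sym d≡) a))
        (trans (cong g (skip-≤ {i} {d} z≤n)) e)
        (trans (cong g (skip-end i d o)) e′)
        (λ u 0<u u< → away (skip i d u) (subst (_< skip i d u) (skip-≤ {i} {d} z≤n) (skip-mono-< 0<u))
          (subst (skip i d u <_) (skip-end i d o) (skip-mono-< u<)))
    repetition : ∀ i j → i < j → j ≤ m → g i ≡ g j → ⊥
    -- A repetition before the end makes `g i` adjacent to `g (suc j)`, which shortens the walk like
    -- a chord. A repetition of the end `t` either identifies `s` with `t` or puts a neighbour of
    -- `v` in the interior.
    repetition i j i<j j≤m r with j ℕ.≟ m
    ... | no ne = chord i (suc j) (<-trans i<j (n<1+n j)) (≤∧≢⇒< j≤m ne)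
                    (λ z → <-irrefl (sym (suc-injective z)) i<j)
                    (subst (λ x → Adj D x (g (suc j))) (sym r) (w j (≤∧≢⇒< j≤m ne)))
    repetition zero    j i<j j≤m r | yes z = s≢t (trans (sym e) (trans r (trans (cong g z) e′)))
    repetition (suc i) j i<j j≤m r | yes z =
      proj₂ (away (suc i) z<s (subst (suc i <_) z i<j))
        (subst (Adj D v) (sym (trans r (trans (cong g z) e′))) vt)

  module _ (W : V D → Set) (v z : V D) where
    private
      Region : V D → Set
      Region x = W x × Away D v x

      Link : V D → V D → Set
      Link x y = Adj D x y × Region x × Region y

    Component : V D → Set
    Component x = Region x × Star Link z x

    -- Dirac's minimal separator between `v` and the component of `z` in `W` minus the closed
    -- neighbourhood of `v`.
    Boundary : V D → Set
    Boundary x = W x × Adj D v x × ∃ λ c → Component c × Adj D x c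

    Closure : V D → Set
    Closure x = Component x ⊎ Boundary x

    closure⊆ : ∀ {x} → Closure x → W x
    closure⊆ (inj₁ ((w , _) , _)) = w
    closure⊆ (inj₂ (w , _))       = w

    v∉closure : ∀ {x} → Closure x → x ≢ v
    v∉closure (inj₁ ((_ , ne , _) , _)) refl = ne refl
    v∉closure (inj₂ (_ , a , _))        refl = adj-irrefl D ll a

    -- Two boundary vertices are common neighbours of `v` joined through the component, whose
    -- vertices are all away from `v`.
    boundary-clique : ∀ {s t} → Boundary s → Boundary t → s ≢ t → ¬ ¬ Adj D s t
    boundary-clique {s} {t} (_ , vs , c , (_ , zc) , sc) (_ , vt , c′ , (rc′ , zc′) , tc′) s≢t ¬st
      -- Each step records that its starting vertex lies in the region, which exempts the end `t`;
      -- the start `s` is prepended afterwards.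
      with m , g , w , e , e′ ← walk-of {R = λ x y → Adj D x y × Region x}
             (Star.map (λ (a , r , _) → a , r) (Star.reverse (λ (a , r , r′) → swap a , r′ , r) zc ◅◅ zc′)
               ◅◅ (swap tc′ , rc′) ◅ ε)
      = common-neighbours-adjacent vs vt s≢t ¬st (suc m) (<-wellFounded _) (prepend s g)
          (λ { zero _ → subst (Adj D s) (sym e) sc ; (suc u) (s<s u<) → proj₁ (w u u<) })
          refl e′
          (λ { (suc u) _ (s<s u<) → proj₂ (proj₂ (w u u<)) })

    -- All neighbours in `W` of a component vertex lie in the closure, so passing from the closure
    -- to `W` adds no neighbours.
    component-simplicial : ∀ {u} → Component u → Simplicial D Closure u → Simplicial D W u
    component-simplicial {u} cu@((wu , au) , zu) (_ , simp) = wu , λ x y wx wy ux uy →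
      simp x y (closed wx ux) (closed wy uy) ux uy
      where
      closed : ∀ {x} → W x → Adj D u x → Closure x
      closed {x} wx ux with adj? D v x
      ... | yes vx = inj₂ (wx , vx , u , cu , swap ux)
      ... | no ¬vx = inj₁ (rx , zu ◅◅ (ux , (wu , au) , rx) ◅ ε)
        where
        rx : Region x
        rx = wx , (λ { refl → proj₂ au (swap ux) }) , ¬vx

  shrink : ∀ {m l v} {W W′ : V D → Set} → length l < suc m → Covers l W → W v →
    (∀ {x} → W′ x → W x × x ≢ v) →
    ∃ λ l′ → length l′ < m × Covers l′ W′
  shrink {m} {l} {v} lt cov wv sub =
    filter (λ x → ¬? (x F.≟ v)) l ,
    <-≤-trans (filter-notAll (λ x → ¬? (x F.≟ v)) l (lose (cov v wv) (λ ne → ne refl))) (≤-pred lt) ,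
    λ x w′ → ∈-filter⁺ (λ x → ¬? (x F.≟ v)) (cov x (proj₁ (sub w′))) (proj₂ (sub w′))

  -- Dirac's argument.  W need not be decidable, so its size is measured by a list covering it
  -- and the case distinctions are made under a double negation.
  simplicial-away : ∀ m (W : V D → Set) l → length l < m → Covers l W →
    ∀ v z → W v → W z → Away D v z → ¬ ¬ (∃ λ u → Simplicial D W u × Away D v u)
  simplicial-away (suc m) W l lt cov v z wv wz az k =
    ¬¬-excluded-middle {A = ∃₂ λ p q → Closure′ p × Closure′ q × Away D p q} λ where
      -- Without a nonadjacent pair the closure is a clique, and `z` itself is simplicial in it.
      (no none) → finish z∈ (inj₁ z∈ , λ x y cx cy _ _ x≢y →
        decidable-stable (adj? D x y) (λ ¬xy → none (x , y , cx , cy , x≢y , ¬xy)))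
      (yes (p , q , inj₂ bp , cq , a)) → from-boundary bp cq a
      -- If the vertex found lies on the boundary, a second search for one away from it must end in
      -- the component, since the boundary is a clique.
      (yes (p , q , inj₁ cp , cq , a)) → ih (inj₁ cp) cq a λ where
        (u , simp@(inj₁ cu , _) , au) → finish cu simp
        (u , (inj₂ bu , _) , au)      → from-boundary bu (inj₁ cp) (away-sym D au)
    where
    Closure′ = Closure W v z
    z∈ : Component W v z z
    z∈ = (wz , az) , ε
    ih : ∀ {p q} → Closure′ p → Closure′ q → Away D p q → ¬ ¬ (∃ λ u → Simplicial D Closure′ u × Away D p u)
    -- The closure omits `v`, so its covering list is strictly shorter.
    ih {p} {q} cp cq a with l′ , lt′ , cov′ ← shrink lt cov wv (λ c → closure⊆ W v z c , v∉closure W v z c) =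
      simplicial-away m Closure′ l′ lt′ cov′ p q cp cq a
    finish : ∀ {u} → Component W v z u → Simplicial D Closure′ u → ⊥
    finish cu simp = k (_ , component-simplicial W v z cu simp , proj₂ (proj₁ cu))
    from-boundary : ∀ {p q} → Boundary W v z p → Closure′ q → Away D p q → ⊥
    from-boundary bp cq a = ih (inj₂ bp) cq a λ where
      (u , simp@(inj₁ cu , _) , _)  → finish cu simp
      (u , (inj₂ bu , _) , ne , na) → boundary-clique W v z bp bu ne na

  simplicial-exists : ∀ W l → Covers l W → ∀ {x} → W x → ¬ ¬ ∃ (Simplicial D W)
  simplicial-exists W l cov {x} wx k =
    ¬¬-excluded-middle {A = ∃₂ λ p q → W p × W q × Away D p q} λ where
      (no none) → k (x , wx , λ y z wy wz _ _ ne →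
        decidable-stable (adj? D y z) (λ ¬yz → none (y , z , wy , wz , ne , ¬yz)))
      (yes (p , q , wp , wq , a)) →
        simplicial-away (suc (length l)) W l ≤-refl cov p q wp wq a (λ (u , s , _) → k (u , s))

-- Large cliques contain large transitive tournaments

AllPairs-resp-⊆ : ∀ {A : Set} {R : A → A → Set} {xs ys : List A} → xs ⊆ ys → AllPairs R ys → AllPairs R xs
AllPairs-resp-⊆ []         []         = []
AllPairs-resp-⊆ (y ∷ʳ s)   (_ ∷ rs)   = AllPairs-resp-⊆ s rs
AllPairs-resp-⊆ (refl ∷ s) (r ∷ rs)   = All-resp-⊆ s r ∷ AllPairs-resp-⊆ s rs

AllPairs-lookup : ∀ {A : Set} {R : A → A → Set} {xs : List A} → AllPairs R xs →
  ∀ {i j} → i F.< j → R (lookup xs i) (lookup xs j)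
AllPairs-lookup {xs = x ∷ xs} (r ∷ rs) {zero}  {suc j} _         = All.lookup r (∈-lookup j)
AllPairs-lookup {xs = x ∷ xs} (r ∷ rs) {suc i} {suc j} (s<s i<j) = AllPairs-lookup rs i<j

split-⊎ : ∀ {A : Set} {P Q : A → Set} {xs} → All (λ x → P x ⊎ Q x) xs →
  ∃₂ λ ps qs → ps ⊆ xs × qs ⊆ xs × All P ps × All Q qs × length ps + length qs ≡ length xs
split-⊎ [] = [] , [] , [] , [] , [] , [] , refl
split-⊎ {xs = x ∷ _} (inj₁ p ∷ rs) with ps , qs , s , t , a , b , e ← split-⊎ rs =
  x ∷ ps , qs , refl ∷ s , x ∷ʳ t , p ∷ a , b , cong suc e
split-⊎ {xs = x ∷ _} (inj₂ q ∷ rs) with ps , qs , s , t , a , b , e ← split-⊎ rs =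
  ps , x ∷ qs , x ∷ʳ s , refl ∷ t , a , q ∷ b , trans (+-suc _ _) (cong suc e)

-- The slack of one allows for the vertex that `transitive-in-clique` removes before splitting the
-- rest.
one-half-large : ∀ a p q → a + a ≤ suc (p + q) → a ≤ p ⊎ a ≤ q
one-half-large a p q le with a ≤? p | a ≤? q
... | yes x | _     = inj₁ x
... | no _  | yes y = inj₂ y
... | no x  | no y  = ⊥-elim (<-irrefl refl (≤-trans (s≤s (≤-reflexive (sym (+-suc p q))))
                        (≤-trans (+-mono-≤ (≰⇒> x) (≰⇒> y)) le)))

-- Take a vertex `x`; the larger of its out- and in-neighbourhoods still has 2 ^ m vertices. Recurse
-- there and put `x` first or last accordingly.
transitive-in-clique : ∀ D {P : V D → Set} m {xs} → AllPairs (Adj D) xs → All P xs → 2 ^ m ≤ length xs →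
  ∃ λ ys → length ys ≡ m × AllPairs (Arc D) ys × All P ys
transitive-in-clique D zero    adj ps le = [] , refl , [] , []
transitive-in-clique D (suc m) {[]} adj ps le = ⊥-elim (<-irrefl refl (<-≤-trans (m^n>0 2 (suc m)) le))
transitive-in-clique D {P} (suc m) {x ∷ xs} (a ∷ adj) (p ∷ ps) le
  with outs , ins , s , t , o , i , e ← split-⊎ a
  with one-half-large (2 ^ m) (length outs) (length ins)
         (subst₂ _≤_ (cong (2 ^ m +_) (+-identityʳ (2 ^ m))) (cong suc (sym e)) le)
... | inj₁ big with ys , l , arcs , q ←
        transitive-in-clique D m (AllPairs-resp-⊆ s adj) (All.zip (o , All-resp-⊆ s ps)) big
    = x ∷ ys , cong suc l , All.map proj₁ q ∷ arcs , p ∷ All.map proj₂ q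
... | inj₂ big with ys , l , arcs , q ←
        transitive-in-clique D m (AllPairs-resp-⊆ t adj) (All.zip (i , All-resp-⊆ t ps)) big
    = ys ++ x ∷ [] , trans (length-++ ys) (trans (+-comm _ 1) (cong suc l))
    , AllPairs.++⁺ arcs ([] ∷ []) (All.map (λ (r , _) → r ∷ []) q)
    , All.++⁺ (All.map proj₂ q) (p ∷ [])

-- Embeddings of C3(1,1,k)

non-arc : ∀ D {x y} → ¬ Arc D x y → arc D x y ≡ false
non-arc D = Bool.¬-not

<ᵇ-true : ∀ {m n} → m < n → (m <ᵇ n) ≡ true
<ᵇ-true lt = Equivalence.to Bool.T-≡ (<⇒<ᵇ lt)

<ᵇ-false : ∀ {m n} → ¬ m < n → (m <ᵇ n) ≡ false
<ᵇ-false {m} {n} nlt = Bool.¬-not (λ e → nlt (<ᵇ⇒< m n (Equivalence.from Bool.T-≡ e)))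

C3[1,1,_] : ℕ → Digraph
C3[1,1, k ] = C3 (TT 1) (TT 1) (TT k)

Increasing : (D : Digraph) {k : ℕ} → (Fin k → V D) → Set
Increasing D h = ∀ {i j} → i F.< j → Arc D (h i) (h j)

module _ (D : Digraph) (or : Oriented D) where
  private
    ll   = proj₁ or
    asym = proj₂ or

  increasing-arcs : ∀ {k} {h : Fin k → V D} → Increasing D h → ∀ i j → arc D (h i) (h j) ≡ (toℕ i <ᵇ toℕ j)
  increasing-arcs {h = h} inc i j with <-cmp (toℕ i) (toℕ j)
  ... | tri< l _ _ = trans (inc l) (sym (<ᵇ-true l))
  ... | tri≈ _ l _ rewrite toℕ-injective l = trans (ll (h j)) (sym (<ᵇ-false {toℕ j} {toℕ j} (<-irrefl refl)))
  ... | tri> n _ l = trans (non-arc D (asym _ _ (inc l))) (sym (<ᵇ-false n))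

  increasing-injective : ∀ {k} {h : Fin k → V D} → Increasing D h → Injective _≡_ _≡_ h
  increasing-injective {h = h} inc {i} {j} e with <-cmp (toℕ i) (toℕ j)
  ... | tri< l _ _ = ⊥-elim (adj-irrefl D ll (inj₁ (subst (Arc D (h i)) (sym e) (inc l))))
  ... | tri≈ _ l _ = toℕ-injective l
  ... | tri> _ _ l = ⊥-elim (adj-irrefl D ll (inj₁ (subst (Arc D (h j)) e (inc l))))

  module _ {a b : V D} {k : ℕ} {h : Fin k → V D} (ab : Arc D a b)
    (bh : ∀ i → Arc D b (h i)) (ha : ∀ i → Arc D (h i) a) (inc : Increasing D h) where

    place : V C3[1,1, k ] → V D
    place zero          = a
    place (suc zero)    = b
    place (suc (suc i)) = h i

    place-arcs : ∀ p q → arc D (place p) (place q) ≡ arc C3[1,1, k ] p q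
    place-arcs zero          zero          = ll a
    place-arcs zero          (suc zero)    = ab
    place-arcs zero          (suc (suc j)) = non-arc D (asym _ _ (ha j))
    place-arcs (suc zero)    zero          = non-arc D (asym _ _ ab)
    place-arcs (suc zero)    (suc zero)    = ll b
    place-arcs (suc zero)    (suc (suc j)) = bh j
    place-arcs (suc (suc i)) zero          = ha i
    place-arcs (suc (suc i)) (suc zero)    = non-arc D (asym _ _ (bh i))
    place-arcs (suc (suc i)) (suc (suc j)) = increasing-arcs inc i j

    place-injective : Injective _≡_ _≡_ place
    place-injective {zero}        {zero}        e = refl
    place-injective {zero}        {suc zero}    refl = ⊥-elim (adj-irrefl D ll (inj₁ ab))
    place-injective {zero}        {suc (suc j)} refl = ⊥-elim (adj-irrefl D ll (inj₁ (ha j)))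
    place-injective {suc zero}    {zero}        refl = ⊥-elim (adj-irrefl D ll (inj₁ ab))
    place-injective {suc zero}    {suc zero}    e = refl
    place-injective {suc zero}    {suc (suc j)} refl = ⊥-elim (adj-irrefl D ll (inj₁ (bh j)))
    place-injective {suc (suc i)} {zero}        refl = ⊥-elim (adj-irrefl D ll (inj₁ (ha i)))
    place-injective {suc (suc i)} {suc zero}    refl = ⊥-elim (adj-irrefl D ll (inj₁ (bh i)))
    place-injective {suc (suc i)} {suc (suc j)} e = cong (λ i → suc (suc i)) (increasing-injective inc e)

    place-induced : InducedIn C3[1,1, k ] D
    place-induced = place , place-injective , place-arcs

-- Greedy colouring along a simplicial elimination

-- This permits choosing one vertex for each colour although the predicate `Closing` need not be
-- decidable.
¬¬-finite : ∀ {n} {P : Fin n → Set} → (∀ i → ¬ ¬ P i) → ¬ ¬ (∀ i → P i)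
¬¬-finite {zero}  f k = k (λ ())
¬¬-finite {suc n} f k = f zero (λ p → ¬¬-finite (f ∘ suc) (λ ps → k (∀-cons p ps)))

MonoTriangleFree : (D : Digraph) {c : ℕ} → (V D → Fin c) → (V D → Set) → Set
MonoTriangleFree D col W = ∀ x y z → W x → W y → W z → DirTriangle D x y z → col x ≡ col y → col y ≡ col z → ⊥

module _ (D : Digraph) (oc : OrientedChordal D) (k : ℕ) (free : ¬ InducedIn C3[1,1, k ] D) where
  private
    ll   = proj₁ (proj₁ oc)
    asym = proj₂ (proj₁ oc)

    c : ℕ
    c = 2 ^ suc (k + k)

    colour₀ : Fin c
    colour₀ = fromℕ< (m^n>0 2 (suc (k + k)))

  no-large-C3 : ∀ {a b ys} → Arc D a b → All (Arc D b) ys → All (λ y → Arc D y a) ys →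
    AllPairs (Arc D) ys → ¬ k ≤ length ys
  no-large-C3 {ys = ys} ab by ya arcs le = free (place-induced D (proj₁ oc) {h = h} ab
    (λ i → All.lookup by (∈-lookup _)) (λ i → All.lookup ya (∈-lookup _))
    (λ {i} {j} i<j → AllPairs-lookup arcs (subst₂ _<_ (sym (toℕ-inject≤ i le)) (sym (toℕ-inject≤ j le)) i<j)))
    where
    h : Fin k → V D
    h i = lookup ys (inject≤ i le)

  module _ (W : V D → Set) (u : V D) where

    -- The in-neighbours of u on a directed triangle through u; giving u a colour
    -- not used on them leaves no monochromatic triangle at u.
    Closing : V D → Set
    Closing b = W b × Arc D b u × ∃ λ a → W a × Arc D u a × Arc D a b

    few-closing : Simplicial D W u → ∀ {ys} → length ys ≡ suc (k + k) → AllPairs (Arc D) ys → All Closing ys → ⊥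
    few-closing (_ , simp) {b ∷ bs} len (b⇒bs ∷ arcs) ((_ , bu , a , wa , ua , ab) ∷ cl)
      -- Both `a` and the remaining closing vertices are neighbours of the simplicial vertex `u`, so
      -- `a` is joined to each of them, in one direction or the other.
      with outs , ins , s , t , o , i , e ← split-⊎ {P = Arc D a} {Q = λ b′ → Arc D b′ a} (All.map
             (λ { (wb′ , b′u , _) → simp _ _ wa wb′ (inj₁ ua) (inj₂ b′u) λ { refl → asym _ _ ua b′u } }) cl)
      with one-half-large k (length outs) (length ins)
             (≤-trans (≤-reflexive (sym (trans e (suc-injective len)))) (ℕ.n≤1+n _))
    ... | inj₁ big = no-large-C3 ua o (All.map (λ (_ , b′u , _) → b′u) (All-resp-⊆ s cl)) (AllPairs-resp-⊆ s arcs) big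
    ... | inj₂ big = no-large-C3 ab (All-resp-⊆ t b⇒bs) i (AllPairs-resp-⊆ t arcs) big

    -- Otherwise pick a closing vertex of every colour. They are distinct neighbours of a simplicial
    -- vertex, hence a clique large enough to contradict `few-closing`.
    free-colour : Simplicial D W u → (col : V D → Fin c) → ¬ ¬ ∃ λ κ → ∀ b → Closing b → col b ≢ κ
    free-colour (wu , simp) col k′ = ¬¬-finite {P = λ κ → ∃ λ b → Closing b × col b ≡ κ}
      (λ κ none → k′ (κ , λ b cb e → none (b , cb , e)))
      λ all-used →
        let g = proj₁ ∘ all-used
            g-closing = λ κ → proj₁ (proj₂ (all-used κ))
            g-injective : ∀ {i j} → g i ≡ g j → i ≡ j
            g-injective {i} {j} e = trans (sym (proj₂ (proj₂ (all-used i))))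
                                      (trans (cong col e) (proj₂ (proj₂ (all-used j))))
            ys , len , arcs , cl = transitive-in-clique D {Closing} (suc (k + k)) {tabulate g}
              (AllPairs.tabulate⁺ (λ {i} {j} i≢j → simp _ _ (proj₁ (g-closing i)) (proj₁ (g-closing j))
                (inj₂ (proj₁ (proj₂ (g-closing i)))) (inj₂ (proj₁ (proj₂ (g-closing j)))) (i≢j ∘ g-injective)))
              (All.tabulate⁺ g-closing) (≤-reflexive (sym (length-tabulate g)))
        in few-closing (wu , simp) len arcs cl

    recolour : (V D → Fin c) → Fin c → V D → Fin c
    recolour col κ x with x F.≟ u
    ... | yes _ = κ
    ... | no _  = col x

    recolour-at : ∀ col κ → recolour col κ u ≡ κ
    recolour-at col κ with u F.≟ u
    ... | yes _ = refl
    ... | no ne = ⊥-elim (ne refl)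

    recolour-off : ∀ col κ {x} → x ≢ u → recolour col κ x ≡ col x
    recolour-off col κ {x} ne with x F.≟ u
    ... | yes e = ⊥-elim (ne e)
    ... | no _  = refl

    closing-keeps-triangle-bichromatic : ∀ col κ → (∀ b → Closing b → col b ≢ κ) →
      ∀ {y z} → W y → W z → DirTriangle D u y z → recolour col κ u ≢ recolour col κ z
    closing-keeps-triangle-bichromatic col κ fresh {y} {z} wy wz (uy , yz , zu) e =
      -- The vertex `z` is closing, with `y` as the third vertex of its triangle.
      fresh z (wz , zu , y , wy , uy , yz)
        (trans (sym (recolour-off col κ λ { refl → adj-irrefl D ll (inj₁ zu) })) (trans (sym e) (recolour-at col κ)))

    recolour-good : ∀ col κ → (∀ b → Closing b → col b ≢ κ) →
      MonoTriangleFree D col (λ x → W x × x ≢ u) → MonoTriangleFree D (recolour col κ) W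
    recolour-good col κ fresh good x y z wx wy wz (xy , yz , zx) e e′ = by-cases (x F.≟ u) (y F.≟ u) (z F.≟ u)
      where
      at-u = closing-keeps-triangle-bichromatic col κ fresh
      by-cases : Dec (x ≡ u) → Dec (y ≡ u) → Dec (z ≡ u) → ⊥
      by-cases (yes refl) _ _ = at-u wy wz (xy , yz , zx) (trans e e′)
      by-cases _ (yes refl) _ = at-u wz wx (yz , zx , xy) (sym e)
      by-cases _ _ (yes refl) = at-u wx wy (zx , xy , yz) (sym e′)
      by-cases (no x≢) (no y≢) (no z≢) = good x y z (wx , x≢) (wy , y≢) (wz , z≢) (xy , yz , zx)
        (subst₂ _≡_ (recolour-off col κ x≢) (recolour-off col κ y≢) e)
        (subst₂ _≡_ (recolour-off col κ y≢) (recolour-off col κ z≢) e′)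

  -- Remove a simplicial vertex, colour the rest and put the vertex back with a free colour; the
  -- elimination order is implicit in the recursion.
  colouring-on : ∀ m W l → length l < m → Covers l W → ¬ ¬ (∃ λ (col : V D → Fin c) → MonoTriangleFree D col W)
  colouring-on (suc m) W l lt cov k′ = ¬¬-excluded-middle {A = ∃ W} λ where
    (no empty) → k′ ((λ _ → colour₀) , λ x _ _ wx → ⊥-elim (empty (x , wx)))
    (yes (_ , wx)) → simplicial-exists D oc W l cov wx λ (u , su) →
      let l′ , lt′ , cov′ = shrink D oc lt cov (proj₁ su) id in
      colouring-on m (λ x → W x × x ≢ u) l′ lt′ cov′ λ (col , good) →
      free-colour W u su col λ (κ , fresh) →
      k′ (recolour W u col κ , recolour-good W u col κ fresh good)

  private
    Good : (V D → Fin c) → Set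
    Good col = ∀ x y z → DirTriangle D x y z → col x ≡ col y → col y ≡ col z → ⊥

    good? : ∀ col → Dec (Good col)
    good? col = all? λ x → all? λ y → all? λ z →
      (arc? D x y ×-dec arc? D y z ×-dec arc? D z x) →-dec (col x F.≟ col y) →-dec (col y F.≟ col z) →-dec no id

    -- There are finitely many colourings, so the double negation in colouring-on can be removed.
    good-colouring : ∃ Good
    good-colouring with any? (λ j → good? (finToFun j))
    ... | yes (j , g) = finToFun j , g
    ... | no none = ⊥-elim (colouring-on _ (λ _ → ⊤) (allFin (size D)) ≤-refl (λ x _ → ∈-allFin x)
      λ (col , g) → none (funToFin col , λ x y z t e e′ → g x y z _ _ _ t
        (subst₂ _≡_ (finToFun-funToFin col x) (finToFun-funToFin col y) e)
        (subst₂ _≡_ (finToFun-funToFin col y) (finToFun-funToFin col z) e′)))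

  dichromatic-bound : DichromaticAtMost D c
  dichromatic-bound with col , good ← good-colouring = col , λ n cyc dc mono →
    let x , y , z , t , px , py , pz = cycle⇒triangle D oc (λ v → col v ≡ col (cyc zero)) n cyc dc mono
    in good x y z t (trans px (sym py)) (trans py (sym pz))

-- Tournaments

adjacent-in-tournament : ∀ D → Tournament D → ∀ {x y} → x ≢ y → Adj D x y
adjacent-in-tournament D (_ , t) ne with t _ _ ne
... | inj₁ (a , _) = inj₁ a
... | inj₂ (a , _) = inj₂ a

arc⇒≢ : ∀ D → Loopless D → ∀ {x y} → Arc D x y → x ≢ y
arc⇒≢ D ll a refl = adj-irrefl D ll (inj₁ a)

semicomplete-chordal : ∀ D → Loopless D → (∀ {x y} → x ≢ y → Adj D x y) → Chordal D
semicomplete-chordal D ll adj = chordal-by-rank D toℕ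
  (λ { x y a e → adj-irrefl D ll (subst (Adj D x) (sym (toℕ-injective e)) a) })
  (λ _ _ _ _ _ _ _ → adj)

tournament-oriented : ∀ D → Tournament D → Oriented D
tournament-oriented D (ll , t) = ll , asym
  where
  asym : ∀ i j → Arc D i j → ¬ Arc D j i
  asym i j a b with t i j (arc⇒≢ D ll a)
  ... | inj₁ (_ , ¬b) = ¬b b
  ... | inj₂ (_ , ¬a) = ¬a a

tournament-chordal : ∀ D → Tournament D → OrientedChordal D
tournament-chordal D t = tournament-oriented D t , semicomplete-chordal D (proj₁ t) (adjacent-in-tournament D t)

TriangleFree : (D : Digraph) → (V D → Set) → Set
TriangleFree D P = ∀ {x y z} → P x → P y → P z → ¬ DirTriangle D x y z

triangle-free-tournament-acyclic : ∀ D → Tournament D → TriangleFree D (λ _ → ⊤) → Acyclic D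
triangle-free-tournament-acyclic D t tf k cyc dc =
  let _ , _ , _ , tri , _ = cycle⇒triangle D (tournament-chordal D t) (λ _ → ⊤) k cyc dc _ in tf _ _ _ tri

triple : ∀ {A : Set} → A → A → A → Fin 3 → A
triple x y z zero             = x
triple x y z (suc zero)       = y
triple x y z (suc (suc zero)) = z

triangle⇒cycle : ∀ D → Loopless D → ∀ {x y z} → DirTriangle D x y z → DirCycle D 2 (triple x y z)
triangle⇒cycle D ll {x} {y} {z} (xy , yz , zx) = inj , arcs
  where
  loop : ∀ {A : Set} {u} → Arc D u u → A
  loop a = ⊥-elim (adj-irrefl D ll (inj₁ a))
  inj : Injective _≡_ _≡_ (triple x y z)
  inj {zero}           {zero}           e    = refl
  inj {zero}           {suc zero}       refl = loop xy
  inj {zero}           {suc (suc zero)} refl = loop zx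
  inj {suc zero}       {zero}           refl = loop xy
  inj {suc zero}       {suc zero}       e    = refl
  inj {suc zero}       {suc (suc zero)} refl = loop yz
  inj {suc (suc zero)} {zero}           refl = loop zx
  inj {suc (suc zero)} {suc zero}       refl = loop yz
  inj {suc (suc zero)} {suc (suc zero)} e    = refl
  arcs : ∀ i j → Consec 3 i j → Arc D (triple x y z i) (triple x y z j)
  arcs zero             (suc zero)       _ = xy
  arcs (suc zero)       (suc (suc zero)) _ = yz
  arcs (suc (suc zero)) zero             _ = zx
  arcs zero             zero             (inj₁ ())
  arcs zero             zero             (inj₂ (() , _))
  arcs zero             (suc (suc zero)) (inj₁ ())
  arcs zero             (suc (suc zero)) (inj₂ (() , _))
  arcs (suc zero)       zero             (inj₁ ())
  arcs (suc zero)       zero             (inj₂ (() , _))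
  arcs (suc zero)       (suc zero)       (inj₁ ())
  arcs (suc zero)       (suc zero)       (inj₂ (_ , ()))
  arcs (suc (suc zero)) (suc zero)       (inj₁ ())
  arcs (suc (suc zero)) (suc zero)       (inj₂ (_ , ()))
  arcs (suc (suc zero)) (suc (suc zero)) (inj₁ ())
  arcs (suc (suc zero)) (suc (suc zero)) (inj₂ (_ , ()))

-- Sorting a transitive tournament

-- If `x` dominates the head `y`, it dominates everything after `y` too, since a later in-neighbour
-- of `x` would complete a directed triangle. Otherwise `y` stays first.
insert-arc-sorted : ∀ D x ys → AllPairs (Arc D) ys → All (Adj D x) ys → TriangleFree D (_∈ x ∷ ys) →
  ∃ λ zs → AllPairs (Arc D) zs × (∀ {v} → v ∈ zs → v ∈ x ∷ ys) × (∀ {v} → v ∈ x ∷ ys → v ∈ zs)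
insert-arc-sorted D x [] _ _ _ = x ∷ [] , [] ∷ [] , id , id
insert-arc-sorted D x (y ∷ ys) (y⇒ys ∷ sorted) (inj₁ xy ∷ adj) tf =
  x ∷ y ∷ ys , (xy ∷ All.tabulate x⇒) ∷ y⇒ys ∷ sorted , id , id
  where
  x⇒ : ∀ {v} → v ∈ ys → Arc D x v
  x⇒ v∈ with All.lookup adj v∈
  ... | inj₁ xv = xv
  ... | inj₂ vx = ⊥-elim (tf (here refl) (there (here refl)) (there (there v∈)) (xy , All.lookup y⇒ys v∈ , vx))
insert-arc-sorted D x (y ∷ ys) (y⇒ys ∷ sorted) (inj₂ yx ∷ adj) tf
  with zs , sorted′ , sound , complete ← insert-arc-sorted D x ys sorted adj 
         (λ a b c → tf (∷⁺ʳ x there a) (∷⁺ʳ x there b) (∷⁺ʳ x there c))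
  = y ∷ zs , All.tabulate (λ v∈ → y⇒ (sound v∈)) ∷ sorted′
  , (λ { (here e) → there (here e) ; (there i) → ∷⁺ʳ x there (sound i) })
  , (λ { (here e) → there (complete (here e)) ; (there (here e)) → here e ; (there (there i)) → there (complete (there i)) })
  where
  y⇒ : ∀ {v} → v ∈ x ∷ ys → Arc D y v
  y⇒ (here refl) = yx
  y⇒ (there i)   = All.lookup y⇒ys i

arc-sort : ∀ D xs → AllPairs (Adj D) xs → TriangleFree D (_∈ xs) →
  ∃ λ zs → AllPairs (Arc D) zs × (∀ {v} → v ∈ zs → v ∈ xs) × (∀ {v} → v ∈ xs → v ∈ zs)
arc-sort D [] _ _ = [] , [] , id , id
arc-sort D (x ∷ xs) (x~xs ∷ adj) tf
  with ys , sorted , sound , complete ← arc-sort D xs adj (λ a b c → tf (there a) (there b) (there c))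
  with zs , sorted′ , sound′ , complete′ ←
    insert-arc-sorted D x ys sorted (All.tabulate (λ v∈ → All.lookup x~xs (sound v∈)))
      (λ a b c → tf (∷⁺ʳ x sound a) (∷⁺ʳ x sound b) (∷⁺ʳ x sound c))
  = zs , sorted′ , ∷⁺ʳ x sound ∘ sound′ , complete′ ∘ ∷⁺ʳ x complete

sort-vertices : ∀ D → Tournament D → {P : V D → Set} (P? : ∀ x → Dec (P x)) → TriangleFree D P →
  ∃ λ zs → AllPairs (Arc D) zs × (∀ {v} → v ∈ zs → P v) × (∀ {v} → P v → v ∈ zs)
sort-vertices D t {P} P? tf =
  let zs , sorted , sound , complete = arc-sort D (filter P? (allFin (size D)))
        (AllPairs.map (adjacent-in-tournament D t) (Unique.filter⁺ P? (Unique.allFin⁺ (size D))))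
        (λ a b c → tf (holds a) (holds b) (holds c))
  in zs , sorted , holds ∘ sound , λ p → complete (∈-filter⁺ P? (∈-allFin _) p)
  where
  holds : ∀ {v} → v ∈ filter P? (allFin (size D)) → P v
  holds i = proj₂ (∈-filter⁻ P? {xs = allFin (size D)} i)

-- The sorted vertices go into the transitive part, behind the two single vertices, so k is the
-- order of `H`.
transitive-induced-in-C3 : ∀ H → TransitiveTournament H → ∃ λ k → InducedIn H C3[1,1, k ]
transitive-induced-in-C3 H (t , acyclic) = length zs , (λ x → suc (suc (pos x))) , inj , arcs
  where
  ll = proj₁ t
  sorting = sort-vertices H t {λ _ → ⊤} (λ _ → yes _)
              (λ _ _ _ tri → acyclic 2 _ (triangle⇒cycle H ll tri))
  zs = proj₁ sorting
  sorted = proj₁ (proj₂ sorting)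
  pos : V H → Fin (length zs)
  pos x = Any.index (proj₂ (proj₂ (proj₂ sorting)) {x} _)
  lookup-pos : ∀ x → x ≡ lookup zs (pos x)
  lookup-pos x = lookup-index (proj₂ (proj₂ (proj₂ sorting)) {x} _)
  inj : Injective _≡_ _≡_ (λ x → Fin.suc (Fin.suc (pos x)))
  inj {x} {y} e = trans (lookup-pos x) (trans (cong (lookup zs) (F.suc-injective (F.suc-injective e))) (sym (lookup-pos y)))
  arcs : ∀ i j → arc C3[1,1, length zs ] (suc (suc (pos i))) (suc (suc (pos j))) ≡ arc H i j
  arcs i j = trans (sym (increasing-arcs H (tournament-oriented H t) (AllPairs-lookup sorted) (pos i) (pos j)))
    (sym (cong₂ (arc H) (lookup-pos i) (lookup-pos j)))

-- The rest has no directed triangle, so it can be sorted into the transitive part; the vertex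
-- outside `a` and `b` gives k ≥ 1.
C3-isomorphism : ∀ H → Tournament H → ∀ a b → Arc H a b →
  (∀ x → x ≢ a → x ≢ b → Arc H b x × Arc H x a) →
  TriangleFree H (λ x → x ≢ a × x ≢ b) → (∃ λ x → x ≢ a × x ≢ b) →
  ∃[ k ] (1 ≤ k × Isomorphic H C3[1,1, k ])
C3-isomorphism H t a b ab mid tf (x₀ , x₀∈) = length zs , nonempty (complete x₀∈) , mk↔ₛ′ pos at pos-at at-pos , arcs
  where
  or = tournament-oriented H t
  Rest : V H → Set
  Rest x = x ≢ a × x ≢ b
  sorting = sort-vertices H t {Rest} (λ x → ¬? (x F.≟ a) ×-dec ¬? (x F.≟ b)) tf
  zs = proj₁ sorting
  sorted = proj₁ (proj₂ sorting)
  sound = proj₁ (proj₂ (proj₂ sorting))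
  complete : ∀ {v} → Rest v → v ∈ zs
  complete = proj₂ (proj₂ (proj₂ sorting))
  nonempty : ∀ {A : Set} {v : A} {xs} → v ∈ xs → 1 ≤ length xs
  nonempty (here _)  = s≤s z≤n
  nonempty (there _) = s≤s z≤n
  middle : ∀ i → Arc H b (lookup zs i) × Arc H (lookup zs i) a
  middle i = let na , nb = sound (∈-lookup i) in mid _ na nb
  at : V C3[1,1, length zs ] → V H
  at = place H or {h = lookup zs} ab (proj₁ ∘ middle) (proj₂ ∘ middle) (AllPairs-lookup sorted)
  locate : ∀ x → ∃ λ p → at p ≡ x
  locate x with x F.≟ a | x F.≟ b
  ... | yes e | _     = zero , sym e
  ... | no _  | yes e = suc zero , sym e
  ... | no na | no nb = suc (suc (Any.index (complete (na , nb)))) , sym (lookup-index (complete (na , nb)))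
  pos = proj₁ ∘ locate
  at-pos : ∀ x → at (pos x) ≡ x
  at-pos x = proj₂ (locate x)
  pos-at : ∀ p → pos (at p) ≡ p
  pos-at p = place-injective H or ab (proj₁ ∘ middle) (proj₂ ∘ middle) (AllPairs-lookup sorted) (at-pos (at p))
  arcs : ∀ i j → arc C3[1,1, length zs ] (pos i) (pos j) ≡ arc H i j
  arcs i j = trans (sym (place-arcs H or ab (proj₁ ∘ middle) (proj₂ ∘ middle) (AllPairs-lookup sorted) (pos i) (pos j)))
    (cong₂ (arc H) (at-pos i) (at-pos j))

-- The listed digraphs are heroes

InducedIn-trans : ∀ {D E F} → InducedIn D E → InducedIn E F → InducedIn D F
InducedIn-trans (f , inj , arcs) (g , inj′ , arcs′) =
  g ∘ f , inj ∘ inj′ , λ i j → trans (arcs′ (f i) (f j)) (arcs i j)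

-- Being a hero passes to induced subdigraphs, as avoiding the smaller digraph implies avoiding the
-- larger.
induced-in-C3⇒hero : ∀ H k → InducedIn H C3[1,1, k ] → Hero OrientedChordal H
induced-in-C3⇒hero H k i = _ , λ D oc free → dichromatic-bound D oc k (free ∘ InducedIn-trans {H} {C3[1,1, k ]} {D} i)

isomorphic⇒induced : ∀ H D → Isomorphic H D → InducedIn H D
isomorphic⇒induced H D (f , arcs) = Inverse.to f ,
  (λ {x} {y} e → trans (sym (Inverse.strictlyInverseʳ f x)) (trans (cong (Inverse.from f) e) (Inverse.strictlyInverseʳ f y))) , arcs

-- Oriented graphs with a perfect elimination ordering

-- The lower-ranked neighbours of every vertex form a clique, which yields chordality; vertices of
-- equal rank are nonadjacent. An arbitrary finite vertex type avoids index arithmetic in sums and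
-- products, and `height` leaves a rank for new vertices on top.
record Ranked : Set₁ where
  infix 4 _⟶_ _⟶?_ _~_
  field
    Vertex : Set
    count  : ℕ
    enum   : Fin count ↔ Vertex
    _⟶_    : Vertex → Vertex → Set
    _⟶?_   : ∀ x y → Dec (x ⟶ y)
    asym   : ∀ {x y} → x ⟶ y → ¬ y ⟶ x

  _~_ : Vertex → Vertex → Set
  x ~ y = x ⟶ y ⊎ y ⟶ x

  field
    rank       : Vertex → ℕ
    height     : ℕ
    rank<      : ∀ x → rank x < height
    rank≢      : ∀ {x y} → x ⟶ y → rank x ≢ rank y
    simplicial : ∀ {x y z} → x ~ y → x ~ z → rank y < rank x → rank z < rank x → y ≢ z → y ~ z

  irrefl : ∀ {x} → ¬ x ⟶ x
  irrefl a = asym a a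

  Triangle : Vertex → Vertex → Vertex → Set
  Triangle x y z = x ⟶ y × y ⟶ z × z ⟶ x

  vertex : Fin count → Vertex
  vertex = Inverse.to enum

  code : Vertex → Fin count
  code = Inverse.from enum

  vertex-code : ∀ x → vertex (code x) ≡ x
  vertex-code = Inverse.strictlyInverseˡ enum

  vertex-injective : ∀ {i j} → vertex i ≡ vertex j → i ≡ j
  vertex-injective {i} {j} e = trans (sym (Inverse.strictlyInverseʳ enum i))
    (trans (cong code e) (Inverse.strictlyInverseʳ enum j))

  _≟_ : (x y : Vertex) → Dec (x ≡ y)
  x ≟ y = map′ (λ e → trans (sym (vertex-code x)) (trans (cong vertex e) (vertex-code y))) (cong code) (code x F.≟ code y)

  all-vertices? : {P : Vertex → Set} → (∀ x → Dec (P x)) → Dec (∀ x → P x)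
  all-vertices? {P} P? = map′ (λ f x → subst P (vertex-code x) (f (code x))) (λ f i → f (vertex i)) (all? (P? ∘ vertex))

  any-vertex? : {P : Vertex → Set} → (∀ x → Dec (P x)) → Dec (∃ P)
  any-vertex? {P} P? = map′ (λ (i , p) → vertex i , p) (λ (x , p) → code x , subst P (sym (vertex-code x)) p) (any? (P? ∘ vertex))

  NoMonoTriangle : ∀ {n} → (Vertex → Fin n) → Set
  NoMonoTriangle col = ∀ {x y z} → Triangle x y z → col x ≡ col y → col y ≡ col z → ⊥

  Uncolourable : ℕ → Set
  Uncolourable n = ∀ (col : Vertex → Fin n) → ¬ NoMonoTriangle col

open Ranked using () renaming (Vertex to ⟨_⟩)

holds : ∀ {P : Set} (d : Dec P) → does d ≡ true → P
holds (yes p) _ = p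

module _ (G : Ranked) where
  open Ranked G

  realise : Digraph
  realise = digraph count (λ i j → does (vertex i ⟶? vertex j))

  realise-arc : ∀ {i j} → Arc realise i j → vertex i ⟶ vertex j
  realise-arc = holds (_ ⟶? _)

  realise-arc⁻¹ : ∀ {x y} → x ⟶ y → Arc realise (code x) (code y)
  realise-arc⁻¹ {x} {y} a = dec-true (_ ⟶? _) (subst₂ _⟶_ (sym (vertex-code x)) (sym (vertex-code y)) a)

  realise-oriented : Oriented realise
  realise-oriented = (λ i → non-arc realise (λ a → irrefl (realise-arc {i} {i} a)))
                   , (λ i j a b → asym (realise-arc a) (realise-arc b))

  realise-adj : ∀ {i j} → Adj realise i j → vertex i ~ vertex j
  realise-adj (inj₁ a) = inj₁ (realise-arc a)
  realise-adj (inj₂ a) = inj₂ (realise-arc a)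

  realise-oriented-chordal : OrientedChordal realise
  realise-oriented-chordal = realise-oriented , chordal-by-rank realise (rank ∘ vertex)
    (λ { x y (inj₁ a) → rank≢ (realise-arc a) ; x y (inj₂ a) → rank≢ (realise-arc a) ∘ sym })
    (λ x y z xy xz y< z< ne → back (simplicial (realise-adj xy) (realise-adj xz) y< z< (ne ∘ vertex-injective)))
    where
    back : ∀ {i j} → vertex i ~ vertex j → Adj realise i j
    back (inj₁ a) = inj₁ (dec-true (_ ⟶? _) a)
    back (inj₂ a) = inj₂ (dec-true (_ ⟶? _) a)

  realise-dichromatic : ∀ {n} → Ranked.Uncolourable G n → ¬ DichromaticAtMost realise n
  realise-dichromatic bad (col , good) = bad (col ∘ code) λ {x} {y} {z} (xy , yz , zx) e e′ →
    good 2 (triple (code x) (code y) (code z))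
      (triangle⇒cycle realise (proj₁ realise-oriented)
        (realise-arc⁻¹ xy , realise-arc⁻¹ yz , realise-arc⁻¹ zx))
      λ { zero → refl ; (suc zero) → sym e ; (suc (suc zero)) → sym (trans e e′) }

-- Completing an oriented graph to a tournament

complete : Digraph → Digraph
complete D = digraph (size D) (λ i j → arc D i j ∨ (not (arc D j i) ∧ (toℕ i <ᵇ toℕ j)))

module _ (D : Digraph) where

  arc-complete : ∀ {i j} → Arc D i j → Arc (complete D) i j
  arc-complete {i} {j} a rewrite a = refl

  complete-tournament : Oriented D → Tournament (complete D)
  complete-tournament (ll , asym) = loopless , directed
    where
    loopless : Loopless (complete D)
    loopless i rewrite ll i = <ᵇ-false {toℕ i} (<-irrefl refl)
    directed : ∀ i j → i ≢ j → (Arc (complete D) i j × ¬ Arc (complete D) j i) ⊎ (Arc (complete D) j i × ¬ Arc (complete D) i j)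
    directed i j ne with arc D i j in ij | arc D j i in ji
    ... | true  | true  = ⊥-elim (asym i j ij ji)
    ... | true  | false = inj₁ (refl , λ ())
    ... | false | true  = inj₂ (refl , λ ())
    ... | false | false with <-cmp (toℕ i) (toℕ j)
    ...   | tri< l _ n = inj₁ (<ᵇ-true l , λ a → case trans (sym (<ᵇ-false n)) a of λ ())
    ...   | tri≈ _ e _ = ⊥-elim (ne (toℕ-injective e))
    ...   | tri> n _ l = inj₂ (<ᵇ-true l , λ a → case trans (sym (<ᵇ-false n)) a of λ ())

  complete-dichromatic : ∀ {n} → DichromaticAtMost (complete D) n → DichromaticAtMost D n
  complete-dichromatic (col , good) = col , λ k cyc (inj , arcs) → good k cyc (inj , λ i j c → arc-complete (arcs i j c))

-- Nested substitutions C3(1,1,·)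

module _ (m : ℕ) (G : Ranked) where
  open Ranked G

  -- There is a copy for every pair, so that the type is a plain product; copies with i ≥ j are not
  -- attached to the base.
  SubstVertex : Set
  SubstVertex = Fin m ⊎ ((Fin m × Fin m) × ⟨ G ⟩)

  -- A transitive tournament on m vertices and, for each of its arcs i → j,
  -- a copy of G turning the arc into C3(i, j, G).
  data SubstArc : SubstVertex → SubstVertex → Set where
    base  : ∀ {i j} → i F.< j → SubstArc (inj₁ i) (inj₁ j)
    enter : ∀ {i j x} → i F.< j → SubstArc (inj₁ j) (inj₂ ((i , j) , x))
    leave : ∀ {i j x} → i F.< j → SubstArc (inj₂ ((i , j) , x)) (inj₁ i)
    inner : ∀ {i j x y} → x ⟶ y → SubstArc (inj₂ ((i , j) , x)) (inj₂ ((i , j) , y))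

  data CopyNeighbour (i j : Fin m) (x : ⟨ G ⟩) : SubstVertex → Set where
    tail-of : i F.< j → CopyNeighbour i j x (inj₁ i)
    head-of : i F.< j → CopyNeighbour i j x (inj₁ j)
    inside  : ∀ {y} → x ~ y → CopyNeighbour i j x (inj₂ ((i , j) , y))

  copy-neighbour : ∀ {i j x w} → SubstArc (inj₂ ((i , j) , x)) w ⊎ SubstArc w (inj₂ ((i , j) , x)) → CopyNeighbour i j x w
  copy-neighbour (inj₁ (leave l)) = tail-of l
  copy-neighbour (inj₁ (inner a)) = inside (inj₁ a)
  copy-neighbour (inj₂ (enter l)) = head-of l
  copy-neighbour (inj₂ (inner a)) = inside (inj₂ a)

  substArc? : ∀ x y → Dec (SubstArc x y)
  substArc? (inj₁ i) (inj₁ j) = map′ base (λ { (base l) → l }) (i F.<? j)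
  substArc? (inj₁ p) (inj₂ ((i , j) , x)) =
    map′ (λ { (refl , l) → enter l }) (λ { (enter l) → refl , l }) ((p F.≟ j) ×-dec (i F.<? j))
  substArc? (inj₂ ((i , j) , x)) (inj₁ p) =
    map′ (λ { (refl , l) → leave l }) (λ { (leave l) → refl , l }) ((p F.≟ i) ×-dec (i F.<? j))
  substArc? (inj₂ ((i , j) , x)) (inj₂ ((i′ , j′) , y)) =
    map′ (λ { (refl , refl , a) → inner a }) (λ { (inner a) → refl , refl , a })
      ((i F.≟ i′) ×-dec (j F.≟ j′) ×-dec (x ⟶? y))

  substitution : Ranked
  substitution = record
    { Vertex = SubstVertex
    ; count  = m + m * m * count
    ; enum   = (↔-id _ ⊎-↔ ((*↔× ×-↔ enum) ↔-∘ *↔×)) ↔-∘ +↔⊎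
    ; _⟶_    = SubstArc
    ; _⟶?_   = substArc?
    ; asym   = asym′
    ; rank   = rank′
    ; height = m + height
    ; rank<  = λ { (inj₁ i) → <-≤-trans (toℕ<n i) (m≤m+n m _) ; (inj₂ (_ , x)) → +-monoʳ-< m (rank< x) }
    ; rank≢  = distinct
    ; simplicial = λ {x} {y} {z} → simplicial′ x y z
    }
    where
    rank′ : SubstVertex → ℕ
    rank′ (inj₁ i)       = toℕ i
    rank′ (inj₂ (_ , x)) = m + rank x
    base<copy : ∀ i {n} → toℕ {m} i < m + n
    base<copy i = <-≤-trans (toℕ<n i) (m≤m+n m _)
    asym′ : ∀ {x y} → SubstArc x y → ¬ SubstArc y x
    asym′ (base l)  (base l′)  = <-asym l l′
    asym′ (enter l) (leave l′) = <-irrefl refl l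
    asym′ (leave l) (enter l′) = <-irrefl refl l
    asym′ (inner a) (inner b)  = asym a b
    distinct : ∀ {x y} → SubstArc x y → rank′ x ≢ rank′ y
    distinct (base l)          = <⇒≢ l
    distinct (enter {j = j} l) = <⇒≢ (base<copy j)
    distinct (leave {i = i} l) = <⇒≢ (base<copy i) ∘ sym
    distinct (inner a)         = rank≢ a ∘ +-cancelˡ-≡ m _ _
    _∼_ : SubstVertex → SubstVertex → Set
    x ∼ y = SubstArc x y ⊎ SubstArc y x
    simplicial′ : ∀ x y z → x ∼ y → x ∼ z → rank′ y < rank′ x → rank′ z < rank′ x → y ≢ z → y ∼ z
    simplicial′ (inj₁ p) (inj₁ q) (inj₁ r) _ _ _ _ ne with <-cmp (toℕ q) (toℕ r)
    ... | tri< l _ _ = inj₁ (base l)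
    ... | tri≈ _ e _ = ⊥-elim (ne (cong inj₁ (toℕ-injective e)))
    ... | tri> _ _ l = inj₂ (base l)
    simplicial′ (inj₁ p) (inj₂ _) _ _ _ lt _ _ = ⊥-elim (<-asym lt (base<copy p))
    simplicial′ (inj₁ p) (inj₁ _) (inj₂ _) _ _ _ lt _ = ⊥-elim (<-asym lt (base<copy p))
    simplicial′ (inj₂ ((i , j) , x)) y z xy xz y< z< ne with copy-neighbour xy | copy-neighbour xz
    ... | tail-of _ | tail-of _ = ⊥-elim (ne refl)
    ... | tail-of l | head-of _ = inj₁ (base l)
    ... | tail-of l | inside _  = inj₂ (leave l)
    ... | head-of l | tail-of _ = inj₂ (base l)
    ... | head-of _ | head-of _ = ⊥-elim (ne refl)
    ... | head-of l | inside _  = inj₁ (enter l)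
    ... | inside _  | tail-of l = inj₁ (leave l)
    ... | inside _  | head-of l = inj₂ (enter l)
    ... | inside a  | inside b  with simplicial a b (ℕ.+-cancelˡ-< m _ _ y<) (ℕ.+-cancelˡ-< m _ _ z<) (λ { refl → ne refl })
    ...   | inj₁ c = inj₁ (inner c)
    ...   | inj₂ c = inj₂ (inner c)

-- Two of the n + 2 base vertices share one of the n + 1 colours. The copy on their arc must avoid
-- it, which leaves n colours; `punchOut` renumbers them.
substitution-uncolourable : ∀ n G → Ranked.Uncolourable G n → Ranked.Uncolourable (substitution (suc (suc n)) G) (suc n)
substitution-uncolourable n G bad col good =
  bad (λ x → punchOut (fresh x)) λ (xy , yz , zx) e e′ →
    good (inner xy , inner yz , inner zx) (punchOut-injective (fresh _) (fresh _) e) (punchOut-injective (fresh _) (fresh _) e′)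
  where
  repeated = pigeonhole (n<1+n (suc n)) (col ∘ inj₁)
  i = proj₁ repeated
  j = proj₁ (proj₂ repeated)
  i<j = proj₁ (proj₂ (proj₂ repeated))
  same = proj₂ (proj₂ (proj₂ repeated))
  fresh : ∀ x → col (inj₁ j) ≢ col (inj₂ ((i , j) , x))
  fresh x e = good (base i<j , enter i<j , leave i<j) same e

point : Ranked
point = record
  { Vertex = Fin 1 ; count = 1 ; enum = ↔-id _ ; _⟶_ = λ _ _ → ⊥ ; _⟶?_ = λ _ _ → no id ; asym = λ ()
  ; rank = λ _ → 0 ; height = 1 ; rank< = λ _ → z<s ; rank≢ = λ () ; simplicial = λ { (inj₁ ()) ; (inj₂ ()) } }

nested : ℕ → Ranked
nested zero    = point
nested (suc n) = substitution (suc (suc n)) (nested n)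

nested-uncolourable : ∀ n → Ranked.Uncolourable (nested n) n
nested-uncolourable zero    col _ = case col zero of λ ()
nested-uncolourable (suc n) = substitution-uncolourable n (nested n) (nested-uncolourable n)

-- Tournaments inside the nested substitutions

DominatingTriangle DominatedTriangle : Digraph → Set
DominatedTriangle H = ∃₂ λ d x → ∃₂ λ y z → DirTriangle H x y z × Arc H d x × Arc H d y × Arc H d z
DominatingTriangle H = ∃₂ λ d x → ∃₂ λ y z → DirTriangle H x y z × Arc H x d × Arc H y d × Arc H z d

ClosingArc : Digraph → Set
ClosingArc H = ∃₂ λ a b → Arc H a b × (∀ x → x ≢ a → x ≢ b → Arc H b x × Arc H x a)

module _ (H : Digraph) (t : Tournament H) where
  private
    ll   = proj₁ t
    asym = proj₂ (tournament-oriented H t)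

  sink⇒dominating : ∀ {d x y z} → (∀ w → w ≢ d → Arc H w d) → DirTriangle H x y z → DominatingTriangle H
  sink⇒dominating {d} sink (xy , yz , zx) =
    d , _ , _ , _ , (xy , yz , zx) , sink _ (off xy) , sink _ (off yz) , sink _ (off zx)
    where
    off : ∀ {u v} → Arc H u v → u ≢ d
    off a refl = asym _ _ a (sink _ (arc⇒≢ H ll a ∘ sym))

  source⇒dominated : ∀ {d x y z} → (∀ w → w ≢ d → Arc H d w) → DirTriangle H x y z → DominatedTriangle H
  source⇒dominated {d} source (xy , yz , zx) =
    d , _ , _ , _ , (xy , yz , zx) , source _ (off zx) , source _ (off xy) , source _ (off yz)
    where
    off : ∀ {u v} → Arc H u v → v ≢ d
    off a refl = asym _ _ a (source _ (arc⇒≢ H ll a))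

  -- Preserving arcs suffices: from a tournament to an oriented graph such a map is injective and
  -- reflects arcs.
  Hom : Ranked → Set
  Hom G = Σ (V H → ⟨ G ⟩) λ f → ∀ {x y} → Arc H x y → Ranked._⟶_ G (f x) (f y)

  module _ (G : Ranked) (F : Hom G) where
    open Ranked G using (_⟶_; _~_; irrefl) renaming (asym to asymG)
    private
      f = proj₁ F

      hom : ∀ {x y} → Arc H x y → f x ⟶ f y
      hom = proj₂ F

    hom-adj : ∀ {x y} → x ≢ y → f x ~ f y
    hom-adj ne with adjacent-in-tournament H t ne
    ... | inj₁ a = inj₁ (hom a)
    ... | inj₂ a = inj₂ (hom a)

    hom-injective : ∀ {x y} → f x ≡ f y → x ≡ y
    hom-injective {x} {y} e with x F.≟ y
    ... | yes p = p
    ... | no ne with hom-adj ne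
    ...   | inj₁ a = ⊥-elim (irrefl (subst (f x ⟶_) (sym e) a))
    ...   | inj₂ a = ⊥-elim (irrefl (subst (_⟶ f x) (sym e) a))

    hom-reflects : ∀ {x y} → f x ⟶ f y → Arc H x y
    hom-reflects {x} {y} a with x F.≟ y
    ... | yes refl = ⊥-elim (irrefl a)
    ... | no ne with adjacent-in-tournament H t ne
    ...   | inj₁ b = b
    ...   | inj₂ b = ⊥-elim (asymG a (hom b))

  module _ (noDominating : ¬ DominatingTriangle H) (noDominated : ¬ DominatedTriangle H)
    {x y z : V H} (tri : DirTriangle H x y z) where

    module _ (m : ℕ) (G : Ranked) (F : Hom (substitution m G)) where
      private
        f = proj₁ F

        hom : ∀ {x y} → Arc H x y → SubstArc m G (f x) (f y)
        hom = proj₂ F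

      InCopy : Fin m → Fin m → V H → Set
      InCopy i j w = ∃ λ v → f w ≡ inj₂ ((i , j) , v)

      -- The base is transitive, so it cannot contain the image of the whole triangle.
      meets-copy : ∃₂ λ w i → ∃ λ j → InCopy i j w
      meets-copy with f x in fx | f y in fy | f z in fz
      ... | inj₂ ((i , j) , v) | _ | _ = x , i , j , v , fx
      ... | inj₁ _ | inj₂ ((i , j) , v) | _ = y , i , j , v , fy
      ... | inj₁ _ | inj₁ _ | inj₂ ((i , j) , v) = z , i , j , v , fz
      ... | inj₁ _ | inj₁ _ | inj₁ _ = ⊥-elim (<-asym
        (<-trans (below fx fy (hom (proj₁ tri))) (below fy fz (hom (proj₁ (proj₂ tri)))))
        (below fz fx (hom (proj₂ (proj₂ tri)))))
        where
        below : ∀ {u v p q} → f u ≡ inj₁ p → f v ≡ inj₁ q → SubstArc m G (f u) (f v) → p F.< q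
        below e e′ a with base l ← subst₂ (SubstArc m G) e e′ a = l

      module _ {u : V H} {i j : Fin m} (c : InCopy i j u) where
        private
          v  = proj₁ c
          fu = proj₂ c

        data Position (w : V H) : Set where
          at-tail : i F.< j → f w ≡ inj₁ i → Position w
          at-head : i F.< j → f w ≡ inj₁ j → Position w
          in-copy : InCopy i j w → Position w

        -- Every other vertex is adjacent to `u`, and a vertex of a copy has neighbours only in that
        -- copy and at the two ends of its arc.
        position : ∀ w → Position w
        position w with u F.≟ w
        ... | yes refl = in-copy (v , fu)
        ... | no ne = from (copy-neighbour m G (subst (λ s → SubstArc m G s (f w) ⊎ SubstArc m G (f w) s) fu (hom-adj (substitution m G) F ne))) refl
          where
          from : ∀ {s} → CopyNeighbour m G i j v s → f w ≡ s → Position w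
          from (tail-of l) e = at-tail l e
          from (head-of l) e = at-head l e
          from (inside _)  e = in-copy (_ , e)

        reflect : ∀ {w w′ s s′} → f w ≡ s → f w′ ≡ s′ → SubstArc m G s s′ → Arc H w w′
        reflect refl refl a = hom-reflects (substitution m G) F a

        unique-at : ∀ {w w′ s} → f w ≡ s → f w′ ≡ s → w ≡ w′
        unique-at e e′ = hom-injective (substitution m G) F (trans e (sym e′))

        At : Fin m → Set
        At p = ∃ λ w → f w ≡ inj₁ p

        copy-arc : ∀ {p} → At p → i F.< j
        copy-arc (w , e) with position w
        ... | at-tail l _ = l
        ... | at-head l _ = l
        ... | in-copy (_ , e′) = case trans (sym e) e′ of λ ()

        at? : ∀ p → Dec (At p)
        at? p = any? (λ w → is-base? (f w))
          where
          is-base? : ∀ s → Dec (s ≡ inj₁ p)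
          is-base? (inj₁ q) = map′ (cong inj₁) inj₁-injective (q F.≟ p)
          is-base? (inj₂ _) = no λ ()

        -- If the image uses both ends of the arc, they form a closing arc. If it uses only the
        -- tail, that vertex is a sink of `H`; if only the head, a source. If it uses neither, `H`
        -- lies in the copy.
        closing-arc-or-smaller : ClosingArc H ⊎ Hom G
        closing-arc-or-smaller with at? i | at? j
        ... | yes (a , fa) | yes (b , fb) = inj₁ (a , b , reflect fa fb (base i<j) , λ w w≢a w≢b → mid (position w) w≢a w≢b)
          where
          i<j = copy-arc (a , fa)
          mid : ∀ {w} → Position w → w ≢ a → w ≢ b → Arc H b w × Arc H w a
          mid (at-tail _ e) w≢a _ = ⊥-elim (w≢a (unique-at e fa))
          mid (at-head _ e) _ w≢b = ⊥-elim (w≢b (unique-at e fb))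
          mid (in-copy (_ , e)) _ _ = reflect fb e (enter i<j) , reflect e fa (leave i<j)
        ... | yes (a , fa) | no none = ⊥-elim (noDominating (sink⇒dominating {a} (λ w → sink (position w)) tri))
          where
          sink : ∀ {w} → Position w → w ≢ a → Arc H w a
          sink (at-tail _ e) w≢a = ⊥-elim (w≢a (unique-at e fa))
          sink (at-head _ e) _   = ⊥-elim (none (_ , e))
          sink (in-copy (_ , e)) _ = reflect e fa (leave (copy-arc (a , fa)))
        ... | no none | yes (b , fb) = ⊥-elim (noDominated (source⇒dominated {b} (λ w → source (position w)) tri))
          where
          source : ∀ {w} → Position w → w ≢ b → Arc H b w
          source (at-tail _ e) _   = ⊥-elim (none (_ , e))
          source (at-head _ e) w≢b = ⊥-elim (w≢b (unique-at e fb))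
          source (in-copy (_ , e)) _ = reflect fb e (enter (copy-arc (b , fb)))
        ... | no none | no none′ = inj₂ (proj₁ ∘ inn , λ {w} {w′} a → inner⁻ (subst₂ (SubstArc m G) (proj₂ (inn w)) (proj₂ (inn w′)) (hom a)))
          where
          inn : ∀ w → InCopy i j w
          inn w with position w
          ... | at-tail _ e = ⊥-elim (none (w , e))
          ... | at-head _ e = ⊥-elim (none′ (w , e))
          ... | in-copy c′  = c′
          inner⁻ : ∀ {p q} → SubstArc m G (inj₂ ((i , j) , p)) (inj₂ ((i , j) , q)) → Ranked._⟶_ G p q
          inner⁻ (inner a) = a

    closing-arc : ∀ n → Hom (nested n) → ClosingArc H
    closing-arc zero    (_ , hom) = ⊥-elim (hom (proj₁ tri))
    closing-arc (suc n) F with _ , _ , _ , c ← meets-copy _ (nested n) F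
      with closing-arc-or-smaller _ (nested n) F c
    ... | inj₁ found = found
    ... | inj₂ F′    = closing-arc n F′

-- Universal one-vertex extensions

DominationFree : Ranked → Set
DominationFree G = ∀ {d x y z} → Triangle x y z → d ⟶ x → d ⟶ y → d ⟶ z → ⊥
  where open Ranked G

pattern outward = zero
pattern inward  = suc zero
pattern absent  = suc (suc zero)

module Extension (G : Ranked) where
  open Ranked G

  -- The adjacency of a new vertex: towards, from, or not to each old vertex.
  Labelling : Set
  Labelling = Vertex → Fin 3

  -- The first condition keeps the elimination ordering. The others keep domination-freeness: the
  -- second treats triangles through the new vertex by forbidding all paths inward, outward, inward;
  -- the third treats triangles dominated by it.
  Attachable : Labelling → Set
  Attachable ℓ =
    (∀ x y → ℓ x ≢ absent → ℓ y ≢ absent → x ≢ y → x ~ y) ×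
    (∀ d x y → ℓ d ≡ inward → ℓ x ≡ outward → ℓ y ≡ inward → d ⟶ x → ¬ x ⟶ y) ×
    (∀ x y z → ℓ x ≡ outward → ℓ y ≡ outward → ℓ z ≡ outward → ¬ Triangle x y z)

  attachable? : ∀ ℓ → Dec (Attachable ℓ)
  attachable? ℓ =
    (all-vertices? λ x → all-vertices? λ y → ¬? (ℓ x F.≟ absent) →-dec ¬? (ℓ y F.≟ absent) →-dec
      ¬? (x ≟ y) →-dec ((x ⟶? y) ⊎-dec (y ⟶? x))) ×-dec
    (all-vertices? λ d → all-vertices? λ x → all-vertices? λ y → (ℓ d F.≟ inward) →-dec (ℓ x F.≟ outward) →-dec
      (ℓ y F.≟ inward) →-dec (d ⟶? x) →-dec ¬? (x ⟶? y)) ×-dec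
    (all-vertices? λ x → all-vertices? λ y → all-vertices? λ z → (ℓ x F.≟ outward) →-dec (ℓ y F.≟ outward) →-dec
      (ℓ z F.≟ outward) →-dec ¬? ((x ⟶? y) ×-dec (y ⟶? z) ×-dec (z ⟶? x)))

  -- One new vertex for each of the labellings, encoded as a number; those that are not attachable
  -- become isolated vertices.
  New : Set
  New = Fin (3 ^ count)

  labelling : New → Labelling
  labelling j x = finToFun j (code x)

  ExtVertex : Set
  ExtVertex = Vertex ⊎ New

  data ExtArc : ExtVertex → ExtVertex → Set where
    old : ∀ {x y} → x ⟶ y → ExtArc (inj₁ x) (inj₁ y)
    out : ∀ {j x} → Attachable (labelling j) → labelling j x ≡ outward → ExtArc (inj₂ j) (inj₁ x)
    inn : ∀ {j x} → Attachable (labelling j) → labelling j x ≡ inward → ExtArc (inj₁ x) (inj₂ j)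

  extArc? : ∀ x y → Dec (ExtArc x y)
  extArc? (inj₁ x) (inj₁ y) = map′ old (λ { (old a) → a }) (x ⟶? y)
  extArc? (inj₂ j) (inj₁ x) = map′ (λ (a , e) → out a e) (λ { (out a e) → a , e })
    (attachable? (labelling j) ×-dec (labelling j x F.≟ outward))
  extArc? (inj₁ x) (inj₂ j) = map′ (λ (a , e) → inn a e) (λ { (inn a e) → a , e })
    (attachable? (labelling j) ×-dec (labelling j x F.≟ inward))
  extArc? (inj₂ _) (inj₂ _) = no λ ()

  extension : Ranked
  extension = record
    { Vertex = ExtVertex
    ; count  = count + 3 ^ count
    ; enum   = (enum ⊎-↔ ↔-id _) ↔-∘ +↔⊎
    ; _⟶_    = ExtArc
    ; _⟶?_   = extArc?
    ; asym   = asym′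
    ; rank   = rank′
    ; height = suc height
    ; rank<  = λ { (inj₁ x) → <-trans (rank< x) (n<1+n _) ; (inj₂ _) → n<1+n _ }
    ; rank≢  = λ { (old a) → rank≢ a ; (out _ _) → <⇒≢ (rank< _) ∘ sym ; (inn _ _) → <⇒≢ (rank< _) }
    ; simplicial = λ {x} {y} {z} → simplicial′ x y z
    }
    where
    rank′ : ExtVertex → ℕ
    rank′ (inj₁ x) = rank x
    rank′ (inj₂ _) = height
    asym′ : ∀ {x y} → ExtArc x y → ¬ ExtArc y x
    asym′ (old a)   (old b)    = asym a b
    asym′ (out _ e) (inn _ e′) = case trans (sym e) e′ of λ ()
    asym′ (inn _ e) (out _ e′) = case trans (sym e) e′ of λ ()
    _∼_ : ExtVertex → ExtVertex → Set
    x ∼ y = ExtArc x y ⊎ ExtArc y x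
    old~ : ∀ {x y} → x ~ y → inj₁ x ∼ inj₁ y
    old~ (inj₁ a) = inj₁ (old a)
    old~ (inj₂ a) = inj₂ (old a)
    old~⁻¹ : ∀ {x y} → inj₁ x ∼ inj₁ y → x ~ y
    old~⁻¹ (inj₁ (old a)) = inj₁ a
    old~⁻¹ (inj₂ (old a)) = inj₂ a
    attached : ∀ {j x} → inj₂ j ∼ inj₁ x → Attachable (labelling j) × labelling j x ≢ absent
    attached (inj₁ (out a e)) = a , λ e′ → case trans (sym e) e′ of λ ()
    attached (inj₂ (inn a e)) = a , λ e′ → case trans (sym e) e′ of λ ()
    simplicial′ : ∀ x y z → x ∼ y → x ∼ z → rank′ y < rank′ x → rank′ z < rank′ x → y ≢ z → y ∼ z
    simplicial′ (inj₁ x) (inj₁ y) (inj₁ z) xy xz y< z< ne =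
      old~ (simplicial (old~⁻¹ xy) (old~⁻¹ xz) y< z< (ne ∘ cong inj₁))
    simplicial′ (inj₁ x) (inj₂ _) _ _ _ lt _ _ = ⊥-elim (<-asym lt (rank< x))
    simplicial′ (inj₁ x) (inj₁ _) (inj₂ _) _ _ _ lt _ = ⊥-elim (<-asym lt (rank< x))
    simplicial′ (inj₂ j) (inj₁ y) (inj₁ z) xy xz _ _ ne
      with att , py ← attached xy | _ , pz ← attached xz = old~ (proj₁ att y z py pz (ne ∘ cong inj₁))
    simplicial′ (inj₂ j) (inj₂ _) _ _ _ lt _ _ = ⊥-elim (<-irrefl refl lt)
    simplicial′ (inj₂ j) (inj₁ _) (inj₂ _) _ _ _ lt _ = ⊥-elim (<-irrefl refl lt)

  -- New vertices are pairwise nonadjacent, so at most one of the four vertices is new, either the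
  -- dominating one or one on the triangle.
  extension-domination-free : DominationFree G → DominationFree extension
  extension-domination-free free (old xy , old yz , old zx) (old dx) (old dy) (old dz) = free (xy , yz , zx) dx dy dz
  extension-domination-free free (old xy , old yz , old zx) (out att px) (out _ py) (out _ pz) =
    proj₂ (proj₂ att) _ _ _ px py pz (xy , yz , zx)
  extension-domination-free free (out att py , old yz , inn _ pz) (inn _ pd) (old dy) (old dz) =
    proj₁ (proj₂ att) _ _ _ pd py pz dy yz
  extension-domination-free free (inn _ px , out att pz , old zx) (old dx) (inn _ pd) (old dz) =
    proj₁ (proj₂ att) _ _ _ pd pz px dz zx
  extension-domination-free free (old xy , inn _ py , out att px) (old dx) (old dy) (inn _ pd) =
    proj₁ (proj₂ att) _ _ _ pd px py dx xy

  attach : ∀ ℓ → Attachable ℓ → ∃ λ j →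
    (∀ {x} → ℓ x ≡ outward → ExtArc (inj₂ j) (inj₁ x)) × (∀ {x} → ℓ x ≡ inward → ExtArc (inj₁ x) (inj₂ j))
  attach ℓ (clique , io , tf) = j
    , (λ {x} e → out attachable (trans (same x) e)) , (λ {x} e → inn attachable (trans (same x) e))
    where
    j = funToFin (ℓ ∘ vertex)
    same : ∀ x → labelling j x ≡ ℓ x
    same x = trans (finToFun-funToFin (ℓ ∘ vertex) (code x)) (cong ℓ (vertex-code x))
    to : ∀ {x c} → labelling j x ≡ c → ℓ x ≡ c
    to {x} = trans (sym (same x))
    attachable : Attachable (labelling j)
    attachable = (λ x y px py → clique x y (px ∘ trans (same x)) (py ∘ trans (same y)))
               , (λ d x y pd px py → io d x y (to pd) (to px) (to py))
               , (λ x y z px py pz → tf x y z (to px) (to py) (to pz))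

-- Transitive cliques

module Cliques (G : Ranked) where
  open Ranked G

  TransitiveClique : (Vertex → Set) → Set
  TransitiveClique P = (∀ {x y} → P x → P y → x ≢ y → x ~ y) × (∀ {x y z} → P x → P y → P z → ¬ Triangle x y z)

  infix 4 _⇛_
  _⇛_ : (Vertex → Set) → (Vertex → Set) → Set
  P ⇛ Q = ∀ {x y} → P x → Q y → x ⟶ y

  clique-⊆ : ∀ {P Q} → (∀ {x} → Q x → P x) → TransitiveClique P → TransitiveClique Q
  clique-⊆ s (c , tf) = (λ a b → c (s a) (s b)) , (λ a b d → tf (s a) (s b) (s d))

  clique-∪ : ∀ {P Q} → TransitiveClique P → TransitiveClique Q → P ⇛ Q → TransitiveClique (λ x → P x ⊎ Q x)
  clique-∪ {P} {Q} (c , tf) (c′ , tf′) pq = adjacent , triangle-free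
    where
    adjacent : ∀ {x y} → P x ⊎ Q x → P y ⊎ Q y → x ≢ y → x ~ y
    adjacent (inj₁ p) (inj₁ q) ne = c p q ne
    adjacent (inj₁ p) (inj₂ q) ne = inj₁ (pq p q)
    adjacent (inj₂ p) (inj₁ q) ne = inj₂ (pq q p)
    adjacent (inj₂ p) (inj₂ q) ne = c′ p q ne
    triangle-free : ∀ {x y z} → P x ⊎ Q x → P y ⊎ Q y → P z ⊎ Q z → ¬ Triangle x y z
    triangle-free (inj₁ a) (inj₁ b) (inj₁ d) t = tf a b d t
    triangle-free (inj₂ a) (inj₂ b) (inj₂ d) t = tf′ a b d t
    triangle-free (inj₁ a) (inj₂ b) (inj₁ d) (_ , yz , _) = asym yz (pq d b)
    triangle-free (inj₁ a) (inj₂ b) (inj₂ d) (_ , _ , zx) = asym zx (pq a d)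
    triangle-free (inj₁ a) (inj₁ b) (inj₂ d) (_ , _ , zx) = asym zx (pq a d)
    triangle-free (inj₂ a) (inj₁ b) _        (xy , _ , _) = asym xy (pq b a)
    triangle-free (inj₂ a) (inj₂ b) (inj₁ d) (_ , yz , _) = asym yz (pq d b)

  clique-singleton : ∀ y → TransitiveClique (_≡ y)
  clique-singleton y = (λ { refl refl ne → ⊥-elim (ne refl) }) , λ { refl refl refl (a , _) → irrefl a }

  module _ {U W P : Vertex → Set} (U? : ∀ x → Dec (U x)) (W? : ∀ x → Dec (W x)) (P? : ∀ x → Dec (P x))
    (cu : TransitiveClique U) (cw : TransitiveClique W) (cp : TransitiveClique P)
    (uw : U ⇛ W) (up : U ⇛ P) (wp : W ⇛ P) where
    open Extension G

    private
      ℓ : Labelling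
      -- The arcs between the three sets make them disjoint, so at most one test succeeds.
      ℓ x with W? x | U? x | P? x
      ... | yes _ | _     | _     = inward
      ... | no _  | yes _ | _     = outward
      ... | no _  | no _  | yes _ = outward
      ... | no _  | no _  | no _  = absent

      ℓ-inward : ∀ {x} → ℓ x ≡ inward → W x
      ℓ-inward {x} e with W? x | U? x | P? x
      ... | yes w | _     | _     = w
      ... | no _  | yes _ | _     = case e of λ ()
      ... | no _  | no _  | yes _ = case e of λ ()
      ... | no _  | no _  | no _  = case e of λ ()

      ℓ-outward : ∀ {x} → ℓ x ≡ outward → U x ⊎ P x
      ℓ-outward {x} e with W? x | U? x | P? x
      ... | yes _ | _     | _     = case e of λ ()
      ... | no _  | yes u | _     = inj₁ u
      ... | no _  | no _  | yes p = inj₂ p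
      ... | no _  | no _  | no _  = case e of λ ()

      ℓ-present : ∀ {x} → ℓ x ≢ absent → U x ⊎ (W x ⊎ P x)
      ℓ-present {x} ne with W? x | U? x | P? x
      ... | yes w | _     | _     = inj₂ (inj₁ w)
      ... | no _  | yes u | _     = inj₁ u
      ... | no _  | no _  | yes p = inj₂ (inj₂ p)
      ... | no _  | no _  | no _  = ⊥-elim (ne refl)

      W-inward : ∀ {x} → W x → ℓ x ≡ inward
      W-inward {x} w with W? x
      ... | yes _ = refl
      ... | no ¬w = ⊥-elim (¬w w)

      outward-if : ∀ {x} → ¬ W x → U x ⊎ P x → ℓ x ≡ outward
      outward-if {x} ¬w up with W? x | U? x | P? x
      ... | yes w | _     | _     = ⊥-elim (¬w w)
      ... | no _  | yes _ | _     = refl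
      ... | no _  | no _  | yes _ = refl
      ... | no _  | no ¬u | no ¬p = ⊥-elim ([ ¬u , ¬p ]′ up)

      -- In the transitive clique U ⇒ W ⇒ P, no path leaves `W` and returns to it through `U` or
      -- `P`; and `U` together with `P` has no directed triangle.
      attachable : Attachable ℓ
      attachable =
        (λ x y px py → proj₁ (clique-∪ cu (clique-∪ cw cp wp) λ u → [ uw u , up u ]′) (ℓ-present px) (ℓ-present py)) ,
        (λ d x y pd px py dx xy → [ (λ u → asym dx (uw u (ℓ-inward pd))) , (λ p → asym xy (wp (ℓ-inward py) p)) ]′ (ℓ-outward px)) ,
        (λ x y z px py pz → proj₂ (clique-∪ cu cp up) (ℓ-outward px) (ℓ-outward py) (ℓ-outward pz))

    -- The new vertex turns each arc from `U` to `W` into a triangle, and it dominates `P`, so it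
    -- can join a block placed in front of `P`.
    close-triangles : ∃ λ y →
      (∀ {u} → U u → ExtArc y (inj₁ u)) × (∀ {w} → W w → ExtArc (inj₁ w) y) × (∀ {p} → P p → ExtArc y (inj₁ p))
    close-triangles with j , o , i ← attach ℓ attachable =
      inj₂ j , (λ u → o (outward-if (λ w → irrefl (uw u w)) (inj₁ u)))
             , (λ w → i (W-inward w))
             , (λ p → o (outward-if (λ w → irrefl (wp w p)) (inj₂ p)))

open Cliques using (TransitiveClique)

record Embedding (G G′ : Ranked) : Set where
  private
    module G = Ranked G
    module G′ = Ranked G′
  field
    map      : ⟨ G ⟩ → ⟨ G′ ⟩
    preserve : ∀ {x y} → x G.⟶ y → map x G′.⟶ map y
    reflects : ∀ {x y} → map x G′.⟶ map y → x G.⟶ y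

  Image : (⟨ G ⟩ → Set) → ⟨ G′ ⟩ → Set
  Image P z = ∃ λ x → P x × map x ≡ z

  image? : ∀ {P} → (∀ x → Dec (P x)) → ∀ z → Dec (Image P z)
  image? P? z = G.any-vertex? (λ x → P? x ×-dec (map x G′.≟ z))

  image-clique : ∀ {P} → TransitiveClique G P → TransitiveClique G′ (Image P)
  image-clique {P} (c , tf) = adjacent , λ { (_ , px , refl) (_ , py , refl) (_ , pz , refl) (xy , yz , zx) →
    tf px py pz (reflects xy , reflects yz , reflects zx) }
    where
    adjacent : ∀ {x y} → Image P x → Image P y → x ≢ y → x G′.~ y
    adjacent (x , px , refl) (y , py , refl) ne with c px py (λ { refl → ne refl })
    ... | inj₁ a = inj₁ (preserve a)
    ... | inj₂ a = inj₂ (preserve a)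

  pull-back : ∀ {n} {col : ⟨ G′ ⟩ → Fin n} → G′.NoMonoTriangle col → G.NoMonoTriangle (col ∘ map)
  pull-back good (xy , yz , zx) = good (preserve xy , preserve yz , preserve zx)

open Embedding

embedding-id : ∀ {G} → Embedding G G
embedding-id = record { map = id ; preserve = id ; reflects = id }

embedding-∘ : ∀ {G₁ G₂ G₃} → Embedding G₂ G₃ → Embedding G₁ G₂ → Embedding G₁ G₃
embedding-∘ F E = record { map = map F ∘ map E ; preserve = preserve F ∘ preserve E ; reflects = reflects E ∘ reflects F }

extension-embedding : ∀ G → Embedding G (Extension.extension G)
extension-embedding G = record { map = inj₁ ; preserve = Extension.old ; reflects = λ { (Extension.old a) → a } }

-- Forcing many colours

funToFin-injective : ∀ {m n} (f g : Fin m → Fin n) → funToFin f ≡ funToFin g → ∀ i → f i ≡ g i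
funToFin-injective f g e i = trans (sym (finToFun-funToFin f i)) (trans (cong (λ t → finToFun t i) e) (finToFun-funToFin g i))

Range : ∀ {A : Set} {c} → (Fin c → A) → A → Set
Range B x = ∃ λ a → x ≡ B a

range? : ∀ G {c} (B : Fin c → ⟨ G ⟩) x → Dec (Range B x)
range? G B x = any? (λ a → Ranked._≟_ G x (B a))

module _ (n : ℕ) where

  -- The set `P` is the part already built, in front of which the block is placed.
  record Rainbow (G : Ranked) (col : ⟨ G ⟩ → Fin n) (P : ⟨ G ⟩ → Set) {c} (B : Fin c → ⟨ G ⟩) : Set where
    field
      distinct : ∀ {a b} → a ≢ b → col (B a) ≢ col (B b)
      clique   : TransitiveClique G (Range B)
      above    : Cliques._⇛_ G (Range B) P
  open Rainbow

  -- The graph `G′` is fixed before the colouring and `P` are known; this uniformity lets forcing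
  -- constructions be composed.
  Forces : (G G′ : Ranked) → Embedding G G′ → ((⟨ G′ ⟩ → Fin n) → (⟨ G′ ⟩ → Set) → Set) → Set₁
  Forces G G′ E Outcome = ∀ (col : ⟨ G′ ⟩ → Fin n) → Ranked.NoMonoTriangle G′ col →
    ∀ {P} → (∀ x → Dec (P x)) → TransitiveClique G P → ¬ ¬ Outcome col (Image E P)

  Forcible : ((G : Ranked) → (⟨ G ⟩ → Fin n) → (⟨ G ⟩ → Set) → Set) → Set₁
  Forcible Outcome = ∀ G → DominationFree G → Σ Ranked λ G′ → DominationFree G′ × Σ (Embedding G G′) λ E →
    Forces G G′ E (Outcome G′)

  RainbowBlock : ℕ → (G : Ranked) → (⟨ G ⟩ → Fin n) → (⟨ G ⟩ → Set) → Set
  RainbowBlock c G col P = ∃ (Rainbow G col P {c})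

  Front : ∀ (G : Ranked) {m c} → (Fin m → Fin c → ⟨ G ⟩) → (⟨ G ⟩ → Set) → ⟨ G ⟩ → Set
  Front G Bs P x = (∃ λ i → Range (Bs i) x) ⊎ P x

  RainbowStack : ℕ → ℕ → (G : Ranked) → (⟨ G ⟩ → Fin n) → (⟨ G ⟩ → Set) → Set
  RainbowStack m c G col P = ∃ λ (Bs : Fin m → Fin c → ⟨ G ⟩) →
    (∀ i → Rainbow G col P (Bs i)) × TransitiveClique G (Front G Bs P) ×
    (∀ {i j} → i F.< j → Cliques._⇛_ G (Range (Bs i)) (Range (Bs j)))

  -- The blocks obtained so far, together with `P`, form the transitive clique in front of which the
  -- next block is forced.
  force-stack : ∀ {c} → Forcible (RainbowBlock c) → ∀ m → Forcible (RainbowStack m c)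
  force-stack force zero G free = G , free , embedding-id , λ col good P? cp k →
    k ((λ ()) , (λ ()) , Cliques.clique-⊆ G (λ { (inj₁ (() , _)) ; (inj₂ (x , p , refl)) → p }) cp , λ { {()} })
  force-stack {c} force (suc m) G free
    with G₁ , free₁ , E₁ , stack ← force-stack force m G free
    with G₂ , free₂ , E₂ , block ← force G₁ free₁
    = G₂ , free₂ , embedding-∘ E₂ E₁ , λ col good {P} P? cp k →
      stack (col ∘ map E₂) (pull-back E₂ good) P? cp λ (Bs , rainbows , cl , order) →
      block col good (front? Bs P?) cl λ (B , r) → k (cons B Bs , rainbows′ rainbows r , clique′ cl r , order′ order r)
    where
    module G₂ = Cliques G₂
    cons : (Fin c → ⟨ G₂ ⟩) → (Fin m → Fin c → ⟨ G₁ ⟩) → Fin (suc m) → Fin c → ⟨ G₂ ⟩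
    cons B Bs zero    = B
    cons B Bs (suc i) = map E₂ ∘ Bs i
    front? : ∀ Bs {P} → (∀ x → Dec (P x)) → ∀ x → Dec (Front G₁ Bs (Image E₁ P) x)
    front? Bs P? x = any? (λ i → range? G₁ (Bs i) x) ⊎-dec image? E₁ P? x
    module _ {col : ⟨ G₂ ⟩ → Fin n} {P : ⟨ G ⟩ → Set} {Bs : Fin m → Fin c → ⟨ G₁ ⟩} where
      rainbows′ : (∀ i → Rainbow G₁ (col ∘ map E₂) (Image E₁ P) (Bs i)) →
        ∀ {B} → Rainbow G₂ col (Image E₂ (Front G₁ Bs (Image E₁ P))) B →
        ∀ i → Rainbow G₂ col (Image (embedding-∘ E₂ E₁) P) (cons B Bs i)
      rainbows′ rs r zero = record
        { distinct = distinct r ; clique = clique r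
        ; above = λ { b (x , p , refl) → above r b (map E₁ x , inj₂ (x , p , refl) , refl) } }
      rainbows′ rs r (suc i) = record
        { distinct = distinct (rs i)
        ; clique = G₂.clique-⊆ (λ { (a , refl) → _ , (a , refl) , refl }) (image-clique E₂ (clique (rs i)))
        ; above = λ { (a , refl) (x , p , refl) → preserve E₂ (above (rs i) (a , refl) (x , p , refl)) } }
      clique′ : TransitiveClique G₁ (Front G₁ Bs (Image E₁ P)) →
        ∀ {B} → Rainbow G₂ col (Image E₂ (Front G₁ Bs (Image E₁ P))) B →
        TransitiveClique G₂ (Front G₂ (cons B Bs) (Image (embedding-∘ E₂ E₁) P))
      clique′ cl r = G₂.clique-⊆
        (λ { (inj₁ (zero , b)) → inj₁ b
           ; (inj₁ (suc i , a , refl)) → inj₂ (_ , inj₁ (i , a , refl) , refl)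
           ; (inj₂ (x , p , refl)) → inj₂ (_ , inj₂ (x , p , refl) , refl) })
        (G₂.clique-∪ (clique r) (image-clique E₂ cl) (above r))
      order′ : (∀ {i j} → i F.< j → Cliques._⇛_ G₁ (Range (Bs i)) (Range (Bs j))) →
        ∀ {B} → Rainbow G₂ col (Image E₂ (Front G₁ Bs (Image E₁ P))) B →
        ∀ {i j} → i F.< j → Range (cons B Bs i) G₂.⇛ Range (cons B Bs j)
      order′ order r {zero}  {suc j} _ b (a , refl) = above r b (_ , inj₁ (j , a , refl) , refl)
      order′ order r {suc i} {suc j} (s<s i<j) (a , refl) (b , refl) = preserve E₂ (order i<j (a , refl) (b , refl))

  module _ (G : Ranked) {c : ℕ} where
    private
      G′ : Ranked
      G′ = Extension.extension G
      E : Embedding G G′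
      E = extension-embedding G
      module G = Cliques G
      module G′ = Cliques G′

    -- A new vertex y with y ⟶ U, W ⟶ y avoids the common colours of U and W.
    enlarge : ∀ (col : ⟨ G′ ⟩ → Fin n) → Ranked.NoMonoTriangle G′ col →
      ∀ {P} → (∀ x → Dec (P x)) → TransitiveClique G P → ∀ {U W : Fin c → ⟨ G ⟩} →
      Rainbow G (col ∘ inj₁) P U → Rainbow G (col ∘ inj₁) P W → Range U G.⇛ Range W →
      (∀ a → col (inj₁ (U a)) ≡ col (inj₁ (W a))) → RainbowBlock (suc c) G′ col (Image E P)
    enlarge col good {P} P? cp {U} {W} ru rw uw same
      with y , yU , Wy , yP ← G.close-triangles (range? G U) (range? G W) P? (clique ru) (clique rw) cp uw (above ru) (above rw)
      = B , record { distinct = distinct′ _ _ ; clique = clique′ ; above = above′ }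
      where
      B : Fin (suc c) → ⟨ G′ ⟩
      B zero    = y
      B (suc a) = inj₁ (W a)
      fresh : ∀ a → col y ≢ col (inj₁ (W a))
      -- The triangle is y → U a → W a → y, and its last two vertices share a colour.
      fresh a e = good (yU (a , refl) , Extension.old (uw (a , refl) (a , refl)) , Wy (a , refl)) (trans e (sym (same a))) (same a)
      distinct′ : ∀ a b → a ≢ b → col (B a) ≢ col (B b)
      distinct′ zero    zero    ne = ⊥-elim (ne refl)
      distinct′ zero    (suc b) ne = fresh b
      distinct′ (suc a) zero    ne = fresh a ∘ sym
      distinct′ (suc a) (suc b) ne = distinct rw (ne ∘ cong suc)
      clique′ : TransitiveClique G′ (Range B)
      clique′ = G′.clique-⊆ {P = λ x → Image E (Range W) x ⊎ x ≡ y}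
        (λ { (zero , e) → inj₂ e ; (suc a , e) → inj₁ (W a , (a , refl) , sym e) })
        (G′.clique-∪ (image-clique E (clique rw)) (G′.clique-singleton y) λ { (_ , w , refl) refl → Wy w })
      above′ : Range B G′.⇛ Image E P
      above′ (zero , refl)  (x , p , refl) = yP p
      above′ (suc a , refl) (x , p , refl) = Extension.old (above rw (a , refl) p)

  -- Among suc (n ^ c) stacked blocks two carry the same colours.
  enlarge-stack : ∀ G c (col : ⟨ Extension.extension G ⟩ → Fin n) → Ranked.NoMonoTriangle (Extension.extension G) col →
    ∀ {P} → (∀ x → Dec (P x)) → TransitiveClique G P → RainbowStack (suc (n ^ c)) c G (col ∘ inj₁) P →
    RainbowBlock (suc c) (Extension.extension G) col (Image (extension-embedding G) P)
  enlarge-stack G c col good P? cp (Bs , rainbows , _ , order) =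
    enlarge G col good P? cp (rainbows i) (rainbows j) (order i<j)
      (funToFin-injective (λ a → col (inj₁ (Bs i a))) (λ a → col (inj₁ (Bs j a))) same)
    where
    repeated = pigeonhole (n<1+n (n ^ c)) (λ i → funToFin (λ a → col (inj₁ (Bs i a))))
    i = proj₁ repeated
    j = proj₁ (proj₂ repeated)
    i<j = proj₁ (proj₂ (proj₂ repeated))
    same = proj₂ (proj₂ (proj₂ repeated))

  -- Induction on the block size: stack n ^ c + 1 blocks of size c, then extend once to enlarge one
  -- of them by a new vertex.
  force-block : ∀ c → Forcible (RainbowBlock c)
  force-block zero G free = G , free , embedding-id , λ col good P? cp k →
    k ((λ ()) , record { distinct = λ { {()} } ; clique = (λ { (() , _) }) , (λ { (() , _) }) ; above = λ { (() , _) } })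
  force-block (suc c) G free with G₁ , free₁ , E₁ , stack ← force-stack (force-block c) (suc (n ^ c)) G free =
    G₂ , Extension.extension-domination-free G₁ free₁ , embedding-∘ E₂ E₁ , λ col good {P} P? cp k →
      stack (col ∘ inj₁) (pull-back E₂ good) P? cp λ st →
      let B , r = enlarge-stack G₁ c col good (image? E₁ P?) (image-clique E₁ cp) st
      in k (B , record { distinct = distinct r ; clique = clique r
                       ; above = λ { b (x , p , refl) → above r b (map E₁ x , (x , p , refl) , refl) } })
    where
    G₂ = Extension.extension G₁
    E₂ = extension-embedding G₁

  -- A rainbow block of n + 1 vertices cannot exist with n colours. The forcing starts from a single
  -- point with `P` empty.
  domination-free-uncolourable : Σ Ranked λ G → DominationFree G × Ranked.Uncolourable G n
  domination-free-uncolourable = let G , free , _ , force = force-block (suc n) point λ { (() , _) } in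
    G , free , λ col good → force col good {λ _ → ⊥} (λ _ → no id) ((λ ()) , (λ ())) λ (B , r) →
      let a , b , a<b , e = pigeonhole (n<1+n n) (col ∘ B) in distinct r (<⇒≢ a<b ∘ cong toℕ) e

-- Heroes have the listed form

opposite : Ranked → Ranked
opposite G = record
  { Vertex = Vertex ; count = count ; enum = enum ; _⟶_ = λ x y → y ⟶ x ; _⟶?_ = λ x y → y ⟶? x ; asym = asym
  ; rank = rank ; height = height ; rank< = rank< ; rank≢ = λ a → rank≢ a ∘ sym
  ; simplicial = λ xy xz y< z< ne → swap (simplicial (swap xy) (swap xz) y< z< ne) }
  where open Ranked G

opposite-uncolourable : ∀ {n} G → Ranked.Uncolourable G n → Ranked.Uncolourable (opposite G) n
opposite-uncolourable G bad col good = bad col λ (xy , yz , zx) e e′ → good (zx , yz , xy) (trans e e′) (sym e′)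

avoid-two : ∀ {n} (a b : Fin n) {x y z} → x ≢ y → y ≢ z → z ≢ x → ∃ λ w → w ≢ a × w ≢ b
avoid-two a b {x} {y} {z} xy yz zx with x F.≟ a | x F.≟ b | y F.≟ a | y F.≟ b
... | no xa    | no xb    | _        | _        = x , xa , xb
... | _        | _        | no ya    | no yb    = y , ya , yb
... | yes refl | _        | yes refl | _        = ⊥-elim (xy refl)
... | yes refl | _        | no _     | yes refl = z , zx , yz ∘ sym
... | no _     | yes refl | yes refl | _        = z , yz ∘ sym , zx
... | no _     | yes refl | no _     | yes refl = ⊥-elim (xy refl)

module _ (H : Digraph) (ll : Loopless H) where

  induced-in-tournament : ∀ D → Tournament D → InducedIn H D → Tournament H
  induced-in-tournament D (_ , t) (f , inj , arcs) = ll , λ i j ne →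
    subst₂ (λ p q → (p ≡ true × ¬ q ≡ true) ⊎ (q ≡ true × ¬ p ≡ true)) (arcs i j) (arcs j i) (t (f i) (f j) (ne ∘ inj))

  tournament-stable : ¬ ¬ Tournament H → Tournament H
  tournament-stable nn = ll , λ i j ne → decidable-stable
    (((arc? H i j) ×-dec ¬? (arc? H j i)) ⊎-dec ((arc? H j i) ×-dec ¬? (arc? H i j)))
    (λ k → nn (λ (_ , t) → k (t i j ne)))

  induced⇒hom : ∀ G → InducedIn H (realise G) → Σ (V H → ⟨ G ⟩) λ f → ∀ {x y} → Arc H x y → Ranked._⟶_ G (f x) (f y)
  induced⇒hom G (f , _ , arcs) = Ranked.vertex G ∘ f , λ {x} {y} a → realise-arc G (trans (arcs x y) a)

  module _ (c : ℕ) (hero : ∀ D → OrientedChordal D → ¬ InducedIn H D → DichromaticAtMost D c) where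

    unavoidable : ∀ G → Ranked.Uncolourable G c → ¬ ¬ InducedIn H (realise G)
    unavoidable G bad none = realise-dichromatic G bad (hero (realise G) (realise-oriented-chordal G) none)

    -- Every induced subdigraph of a tournament is a tournament. Were `H` not one, the completed
    -- nested graphs would avoid it with unbounded dichromatic number.
    hero-tournament : Tournament H
    hero-tournament = tournament-stable λ k →
      realise-dichromatic (nested c) (nested-uncolourable c)
        (complete-dichromatic D (hero (complete D) (tournament-chordal (complete D) t)
          (λ i → k (induced-in-tournament (complete D) t i))))
      where
      D = realise (nested c)
      t = complete-tournament D (realise-oriented (nested c))

    hero-no-dominated : ¬ DominatedTriangle H
    hero-no-dominated (d , x , y , z , (xy , yz , zx) , dx , dy , dz) =
      let G , free , bad = domination-free-uncolourable c in
      unavoidable G bad λ i → let _ , hom = induced⇒hom G i in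
        free (hom xy , hom yz , hom zx) (hom dx) (hom dy) (hom dz)

    hero-no-dominating : ¬ DominatingTriangle H
    hero-no-dominating (d , x , y , z , (xy , yz , zx) , xd , yd , zd) =
      let G , free , bad = domination-free-uncolourable c in
      -- Reversing all arcs turns a triangle that dominates a vertex into one dominated by it.
      unavoidable (opposite G) (opposite-uncolourable G bad) λ i → let _ , hom = induced⇒hom (opposite G) i in
        free (hom zx , hom yz , hom xy) (hom xd) (hom zd) (hom yd)

    closing-arc? : Dec (ClosingArc H)
    closing-arc? = any? λ a → any? λ b → arc? H a b ×-dec all? λ x →
      ¬? (x F.≟ a) →-dec ¬? (x F.≟ b) →-dec (arc? H b x ×-dec arc? H x a)

    hero-closing-arc : ∀ {x y z} → DirTriangle H x y z → ClosingArc H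
    hero-closing-arc tri = decidable-stable closing-arc? λ none →
      unavoidable (nested c) (nested-uncolourable c) λ i →
        none (closing-arc H hero-tournament hero-no-dominating hero-no-dominated tri c (induced⇒hom (nested c) i))

    hero-form : TransitiveTournament H ⊎ ∃[ k ] (1 ≤ k × Isomorphic H C3[1,1, k ])
    hero-form with any? (λ x → any? (λ y → any? (λ z → arc? H x y ×-dec arc? H y z ×-dec arc? H z x)))
    ... | no none = inj₁ (t , triangle-free-tournament-acyclic H t (λ {x} {y} {z} _ _ _ tri → none (x , y , z , tri)))
      where t = hero-tournament
    ... | yes (x , y , z , xy , yz , zx) with a , b , ab , mid ← hero-closing-arc (xy , yz , zx) =
      inj₂ (C3-isomorphism H hero-tournament a b ab mid
        -- A directed triangle outside the closing arc would dominate `a`.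
        (λ { (na , nb) (na′ , nb′) (na″ , nb″) tri → hero-no-dominating
          (a , _ , _ , _ , tri , proj₂ (mid _ na nb) , proj₂ (mid _ na′ nb′) , proj₂ (mid _ na″ nb″)) })
        (avoid-two a b (arc⇒≢ H ll xy) (arc⇒≢ H ll yz) (arc⇒≢ H ll zx)))

theorem10p1p1 : (H : Digraph) → Loopless H →
    Hero OrientedChordal H ⇔
    (TransitiveTournament H ⊎ ∃[ k ] (1 ≤ k × Isomorphic H (C3 (TT 1) (TT 1) (TT k))))
theorem10p1p1 H ll = mk⇔ (λ (c , hero) → hero-form H ll c hero) λ where
  (inj₁ tt) → let k , i = transitive-induced-in-C3 H tt in induced-in-C3⇒hero H k i
  (inj₂ (k , _ , iso)) → induced-in-C3⇒hero H k (isomorphic⇒induced H C3[1,1, k ] iso)
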